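{- There is an algorithm that, for every $d\ge 1$ and every finite set of vectors $V\subseteq\mathbb{R}^d$, finds an $\tilde O(d)$-spectral $d$-spanner $U\subseteq V$ of $V$ of size $|U|\le\tilde O(d)$, in time polynomial in $d$ and $|V|$. In particular there are universal constants $C,c>0$ such that every finite $V\subseteq\mathbb{R}^d$ has a subset $U\subseteq V$ with $|U|\le C d(1+\log d)^c$ such that for every $v\in V$ there is a probability distribution $\mu_v$ on $U$ with $vv^\intercal\preceq C d(1+\log d)^c\cdot\mathbb{E}_{u\sim\mu_v}[uu^\intercal]$.
   Context: $\preceq$ is the Loewner order on symmetric matrices. For $V\subseteq\mathbb{R}^d$, a subset $U\subseteq V$ is an $\alpha$-spectral $d$-spanner of $V$ if for every $v\in V$ there is a probability distribution $\mu_v$ on $U$ with $vv^\intercal\preceq\alpha\cdot\mathbb{E}_{u\sim\mu_v}[uu^\intercal]$, equivalently $\langle x,v\rangle^2\le\alpha\,\mathbb{E}_{u\sim\mu_v}\langle x,u\rangle^2$ for all $x\in\mathbb{R}^d$. The notation $\tilde O(f)$ hides logarithmic factors in $f$; i.e. $\tilde O(d)$ denotes a quantity at most $C d(1+\log d)^c$ for universal constants $C,c>0$. -}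

module Defs where

open import Algebra.Bundles using (CommutativeRing)
open import Data.Bool using (Bool; true; false; if_then_else_; not; _∧_)
open import Data.Fin using (Fin; toℕ; fromℕ<)
open import Data.Fin.Subset using (Subset; _∉_)
open import Data.Nat using (ℕ; suc; _∸_; _^_; _≡ᵇ_; _≤ᵇ_; _<ᵇ_; _<?_)
  renaming (_+_ to _+ℕ_; _*_ to _*ℕ_)
open import Data.Nat.Logarithm using (⌊log₂_⌋)
open import Data.Product using (Σ-syntax; ∃; ∃-syntax; _×_)
open import Data.Vec using (tabulate)
open import Data.Vec.Functional using (Vector)
open import Function using (_∘_)
open import Level using (Level; _⊔_) renaming (suc to lsuc)
open import Relation.Binary.PropositionalEquality using (_≡_)
open import Relation.Binary.Structures using (IsDecTotalOrder)
open import Relation.Nullary using (¬_; yes; no; does)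

-- The real numbers, axiomatised as a complete ordered field. As in classical
-- analysis (and in the real RAM model below), comparisons are decidable.

record Reals (a ℓ₁ ℓ₂ : Level) : Set (lsuc (a ⊔ ℓ₁ ⊔ ℓ₂)) where
  field
    commutativeRing : CommutativeRing a ℓ₁

  open CommutativeRing commutativeRing public
    using (Carrier; _≈_; _+_; _*_; -_; _-_; 0#; 1#)

  infix 4 _≤_
  infix 8 _⁻¹

  field
    _≤_             : Carrier → Carrier → Set ℓ₂
    isDecTotalOrder : IsDecTotalOrder _≈_ _≤_
    +-monoˡ-≤       : ∀ z {x y} → x ≤ y → x + z ≤ y + z
    *-nonNegative   : ∀ {x y} → 0# ≤ x → 0# ≤ y → 0# ≤ x * y
    0≉1             : ¬ (0# ≈ 1#)
    -- The value of 0# ⁻¹ is unspecified.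
    _⁻¹             : Carrier → Carrier
    ⁻¹-inverseʳ     : ∀ {x} → ¬ (x ≈ 0#) → x * x ⁻¹ ≈ 1#

  IsUpperBound : (Carrier → Set (a ⊔ ℓ₁ ⊔ ℓ₂)) → Carrier → Set (a ⊔ ℓ₁ ⊔ ℓ₂)
  IsUpperBound P b = ∀ x → P x → x ≤ b

  field
    complete : ∀ (P : Carrier → Set (a ⊔ ℓ₁ ⊔ ℓ₂)) → ∃ P → ∃ (IsUpperBound P) →
               ∃[ s ] (IsUpperBound P s × (∀ b → IsUpperBound P b → s ≤ b))

  open IsDecTotalOrder isDecTotalOrder public using (_≤?_)

-- The bound C d (1 + log d)^c. Replacing ⌊log₂ d⌋ by any other logarithm of d
-- changes 1 + log d by at most a constant factor.

Õ : (C c d : ℕ) → ℕ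
Õ C c d = C *ℕ d *ℕ (1 +ℕ ⌊log₂ d ⌋) ^ c

-- Programs of a uniform real RAM: a while language over two-dimensional arrays
-- of reals and one-dimensional arrays of natural numbers, all unbounded and
-- addressable by computed indices. A scalar variable is a cell with index 0.
-- Natural numbers cannot be multiplied in one step, so they have polynomially
-- many bits in the running time; and they cannot be extracted from reals.

Name : Set
Name = ℕ

infixl 6 _⊕_ _⊖_ _⊞_ _⊟_
infixl 7 _⊠_
infix  4 _≤ⁿ_ _≤ʳ_
infixr 3 _and_
infixr 2 _﹔_

data NatExp : Set where
  lit     : ℕ → NatExp
  cell    : Name → NatExp → NatExp
  _⊕_ _⊖_ : NatExp → NatExp → NatExp

data RealExp : Set where
  𝟎 𝟏         : RealExp
  cell        : Name → NatExp → NatExp → RealExp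
  _⊞_ _⊟_ _⊠_ : RealExp → RealExp → RealExp
  inv         : RealExp → RealExp

data Test : Set where
  _≤ⁿ_  : NatExp → NatExp → Test
  _≤ʳ_  : RealExp → RealExp → Test
  neg   : Test → Test
  _and_ : Test → Test → Test

data Program : Set where
  skip    : Program
  setNat  : Name → NatExp → NatExp → Program
  setReal : Name → NatExp → NatExp → RealExp → Program
  _﹔_    : Program → Program → Program
  ifte    : Test → Program → Program → Program
  while   : Test → Program → Program

module Spanners {a ℓ₁ ℓ₂} (R : Reals a ℓ₁ ℓ₂) where

  open Reals R
  open import Algebra.Properties.CommutativeMonoid.Sum
    (CommutativeRing.+-commutativeMonoid commutativeRing) using (sum; sum-syntax)
  open import Algebra.Definitions.RawMonoid
    (CommutativeRing.+-rawMonoid commutativeRing) using () renaming (_×_ to _·_)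

  fromℕ : ℕ → Carrier
  fromℕ n = n · 1#

  Vect : ℕ → Set a
  Vect d = Vector Carrier d

  Matrix : ℕ → Set a
  Matrix d = Fin d → Fin d → Carrier

  outer : ∀ {d} → Vect d → Matrix d
  outer v i j = v i * v j

  record PositiveSemidefinite {d} (M : Matrix d) : Set (a ⊔ ℓ₁ ⊔ ℓ₂) where
    field
      symmetric   : ∀ i j → M i j ≈ M j i
      nonNegative : ∀ (x : Vect d) →
                    0# ≤ (∑[ i < d ] ∑[ j < d ] (x i * (M i j * x j)))

  infix 4 _⪯_
  _⪯_ : ∀ {d} → Matrix d → Matrix d → Set (a ⊔ ℓ₁ ⊔ ℓ₂)
  A ⪯ B = PositiveSemidefinite (λ i j → B i j - A i j)

  infixr 7 _•_
  _•_ : ∀ {d} → Carrier → Matrix d → Matrix d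
  (α • M) i j = α * M i j

  -- A finite set of n vectors is given by an enumeration without repetitions;
  -- its subsets are then the subsets of the index set Fin n.

  Distinct : ∀ {d n} → Vector (Vect d) n → Set ℓ₁
  Distinct V = ∀ i j → (∀ k → V i k ≈ V j k) → i ≡ j

  record Distribution {n} (U : Subset n) : Set (a ⊔ ℓ₁ ⊔ ℓ₂) where
    field
      weight      : Fin n → Carrier
      nonNegative : ∀ i → 0# ≤ weight i
      supported   : ∀ i → i ∉ U → weight i ≈ 0#
      total       : sum weight ≈ 1#

  𝔼 : ∀ {d n} {U : Subset n} → Distribution U → (Fin n → Matrix d) → Matrix d
  𝔼 {n = n} μ F i j = ∑[ u < n ] (Distribution.weight μ u * F u i j)

  IsSpectralSpanner : ∀ {d n} → Carrier → Vector (Vect d) n → Subset n →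
                      Set (a ⊔ ℓ₁ ⊔ ℓ₂)
  IsSpectralSpanner α V U =
    ∀ v → Σ[ μ ∈ Distribution U ] (outer (V v) ⪯ α • 𝔼 μ (outer ∘ V))

  record State : Set a where
    constructor state
    field
      nats  : Name → ℕ → ℕ
      reals : Name → ℕ → ℕ → Carrier

  open State

  writeNat : Name → ℕ → ℕ → State → State
  writeNat x i m s = record s
    { nats = λ y j → if (x ≡ᵇ y) ∧ (i ≡ᵇ j) then m else nats s y j }

  writeReal : Name → ℕ → ℕ → Carrier → State → State
  writeReal x i j r s = record s
    { reals = λ y k l →
        if (x ≡ᵇ y) ∧ (i ≡ᵇ k) ∧ (j ≡ᵇ l) then r else reals s y k l }

  ⟦_⟧ⁿ : NatExp → State → ℕ
  ⟦ lit m ⟧ⁿ    s = m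
  ⟦ cell x e ⟧ⁿ s = nats s x (⟦ e ⟧ⁿ s)
  ⟦ e ⊕ f ⟧ⁿ    s = ⟦ e ⟧ⁿ s +ℕ ⟦ f ⟧ⁿ s
  ⟦ e ⊖ f ⟧ⁿ    s = ⟦ e ⟧ⁿ s ∸ ⟦ f ⟧ⁿ s

  ⟦_⟧ʳ : RealExp → State → Carrier
  ⟦ 𝟎 ⟧ʳ          s = 0#
  ⟦ 𝟏 ⟧ʳ          s = 1#
  ⟦ cell x e f ⟧ʳ s = reals s x (⟦ e ⟧ⁿ s) (⟦ f ⟧ⁿ s)
  ⟦ p ⊞ q ⟧ʳ      s = ⟦ p ⟧ʳ s + ⟦ q ⟧ʳ s
  ⟦ p ⊟ q ⟧ʳ      s = ⟦ p ⟧ʳ s - ⟦ q ⟧ʳ s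
  ⟦ p ⊠ q ⟧ʳ      s = ⟦ p ⟧ʳ s * ⟦ q ⟧ʳ s
  ⟦ inv p ⟧ʳ      s = (⟦ p ⟧ʳ s) ⁻¹

  ⟦_⟧ᵗ : Test → State → Bool
  ⟦ e ≤ⁿ f ⟧ᵗ  s = ⟦ e ⟧ⁿ s ≤ᵇ ⟦ f ⟧ⁿ s
  ⟦ p ≤ʳ q ⟧ᵗ  s = does (⟦ p ⟧ʳ s ≤? ⟦ q ⟧ʳ s)
  ⟦ neg b ⟧ᵗ   s = not (⟦ b ⟧ᵗ s)
  ⟦ b and c ⟧ᵗ s = ⟦ b ⟧ᵗ s ∧ ⟦ c ⟧ᵗ s

  -- ⟨ P , s ⟩⇓⟨ s′ , t ⟩: started in state s, P halts in state s′ after t steps.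
  -- Assignments and tests cost one step each; since the expressions in a fixed
  -- program have bounded size, charging for every operation inside them would
  -- only change t by a constant factor.

  data ⟨_,_⟩⇓⟨_,_⟩ : Program → State → State → ℕ → Set a where
    ⇓skip    : ∀ {s} → ⟨ skip , s ⟩⇓⟨ s , 1 ⟩
    ⇓setNat  : ∀ {s x e f} →
               ⟨ setNat x e f , s ⟩⇓⟨ writeNat x (⟦ e ⟧ⁿ s) (⟦ f ⟧ⁿ s) s , 1 ⟩
    ⇓setReal : ∀ {s x e f p} →
               ⟨ setReal x e f p , s ⟩⇓⟨
                 writeReal x (⟦ e ⟧ⁿ s) (⟦ f ⟧ⁿ s) (⟦ p ⟧ʳ s) s , 1 ⟩
    ⇓seq     : ∀ {P Q s s′ s″ t u} →
               ⟨ P , s ⟩⇓⟨ s′ , t ⟩ → ⟨ Q , s′ ⟩⇓⟨ s″ , u ⟩ →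
               ⟨ P ﹔ Q , s ⟩⇓⟨ s″ , t +ℕ u ⟩
    ⇓if-true : ∀ {b P Q s s′ t} → ⟦ b ⟧ᵗ s ≡ true →
               ⟨ P , s ⟩⇓⟨ s′ , t ⟩ → ⟨ ifte b P Q , s ⟩⇓⟨ s′ , suc t ⟩
    ⇓if-false : ∀ {b P Q s s′ t} → ⟦ b ⟧ᵗ s ≡ false →
               ⟨ Q , s ⟩⇓⟨ s′ , t ⟩ → ⟨ ifte b P Q , s ⟩⇓⟨ s′ , suc t ⟩
    ⇓while-true : ∀ {b P s s′ s″ t u} → ⟦ b ⟧ᵗ s ≡ true →
               ⟨ P , s ⟩⇓⟨ s′ , t ⟩ → ⟨ while b P , s′ ⟩⇓⟨ s″ , u ⟩ →
               ⟨ while b P , s ⟩⇓⟨ s″ , suc (t +ℕ u) ⟩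
    ⇓while-false : ∀ {b P s} → ⟦ b ⟧ᵗ s ≡ false →
               ⟨ while b P , s ⟩⇓⟨ s , 1 ⟩

  -- Input convention: nat variables 0 and 1 hold d and n, real array 0 holds
  -- the n vectors as rows, and every other cell is zero.

  entry : ∀ {d n} → Vector (Vect d) n → ℕ → ℕ → Carrier
  entry {d} {n} V i j with i <? n | j <? d
  ... | yes i<n | yes j<d = V (fromℕ< i<n) (fromℕ< j<d)
  ... | _       | _       = 0#

  input : ∀ {d n} → Vector (Vect d) n → State
  input {d} {n} V = state natInput realInput
    where
    natInput : Name → ℕ → ℕ
    natInput 0 0 = d
    natInput 1 0 = n
    natInput _ _ = 0

    realInput : Name → ℕ → ℕ → Carrier
    realInput 0 i j = entry V i j
    realInput _ _ _ = 0#

  -- Output convention: vector i is selected iff cell i of nat array 2 is nonzero.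

  output : ∀ {n} → State → Subset n
  output s = tabulate (λ i → 0 <ᵇ nats s 2 (toℕ i))

{-# OPTIONS --safe #-}
module Submission where

-- Let M = Σ_{u ∈ U} u uᵀ. If v vᵀ ⪯ M for every v in V, then the uniform
-- distribution on U shows that U is a |U|-spectral spanner, so it suffices to
-- reach this with a small U. Gaussian elimination with the largest pivot of each
-- column selects at most d vectors and yields coordinates in which all of V lies
-- in the box [-1, 1]^d and M has determinant 1 (on the columns that do not vanish
-- identically). One pass over V then adds v to U whenever vᵀ M⁻¹ v > 1. Each
-- addition multiplies det M by 1 + vᵀ M⁻¹ v > 2, while Hadamard's inequality
-- bounds det M by |U|^d; hence 2^|U| ≤ (4 |U|)^d, which forces
-- |U| < 8 d (1 + log d). The determinant is never formed: triangular coordinate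
-- changes keep M diagonal, and the product of the diagonal plays that role. U is a
-- multiset, so that a vector may be selected more than once.

open import Defs
open import Algebra.Bundles using (CommutativeRing; RawRing)
open import Algebra.Solver.Ring.AlmostCommutativeRing using (fromCommutativeRing; _-Raw-AlmostCommutative⟶_; Induced-equivalence)
import Algebra.Solver.Ring
import Algebra.Properties.Ring
import Algebra.Properties.Semiring.Mult
import Algebra.Properties.Semiring.Mult.TCOptimised
import Algebra.Properties.Semiring.Sum
open import Data.Bool using (Bool; true; false; _∨_; T)
open import Data.Empty using (⊥-elim)
open import Data.Fin as Fin using (Fin; toℕ; fromℕ<)
import Data.Fin.Properties as Fin
open import Data.Fin.Subset using (Subset; ∣_∣; _∉_)
open import Data.Maybe using (just; nothing)
open import Data.Nat as ℕ using (ℕ; zero; suc; z≤n; s≤s; _≡ᵇ_)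
open import Data.Nat.Logarithm using (⌊log₂_⌋; ⌊log₂⌋-mono-≤; ⌊log₂[2^n]⌋≡n)
import Data.Nat.Properties as ℕ
open import Data.Nat.Solver using (module +-*-Solver)
open import Data.Product using (Σ-syntax; ∃-syntax; _×_; _,_; proj₁; proj₂)
open import Data.Sum using (_⊎_; inj₁; inj₂)
open import Data.Vec using (tabulate)
open import Data.Vec.Functional using (Vector)
import Data.Vec.Properties as Vec
open import Function using (_∘_)
open import Level using (Level; 0ℓ; _⊔_)
open import Relation.Binary.Bundles using (Poset)
open import Relation.Binary.Definitions using (WeaklyDecidable)
open import Relation.Binary.PropositionalEquality as ≡ using (_≡_; _≢_)
import Relation.Binary.Reasoning.PartialOrder
import Relation.Binary.Reasoning.Setoid
open import Relation.Binary.Structures using (IsDecTotalOrder)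
open import Relation.Nullary using (¬_; yes; no)

-- The box and a diagonal lower bound for M are not kept in the same coordinates: the changes that
-- keep the bound diagonal move vectors out of the box. Every column that does not vanish therefore
-- carries a linear functional, with coefficient 1 at this column and 0 at all later ones, that
-- still takes values in [-1, 1] on V. The changes made after the column has been processed preserve
-- these coefficients. At such a functional g the value gᵀ M g is at most |U| and at least the
-- diagonal entry of the column; this takes the place of Hadamard's inequality. Functionals also
-- remove M⁻¹ from the invariants: the condition on v becomes (g · v)² ≤ gᵀ M g for all g, which
-- makes sense even if V does not span the space. Only a lower bound diag(D) of M is kept, since the
-- initial choice of vector 0 is not counted in it. A lower bound is enough both for covering a
-- vector and for bounding the entries of D by |U|. The choice of vector 0 and at most d pivots
-- precede any doubling, whence 2^|U| ≤ 2^(d+1) |U|^d ≤ (4 |U|)^d for d ≥ 1.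

module IntegerRingSolver {a ℓ} (R : CommutativeRing a ℓ) where

  open CommutativeRing R hiding (zero)
  open Algebra.Properties.Ring ring using (-‿distribˡ-*; -‿distribʳ-*; -‿+-comm; -‿involutive; -0#≈0#)
  open Algebra.Properties.Semiring.Mult.TCOptimised semiring using (×-homo-+; ×1-homo-*)
    renaming (_×_ to _·_)
  open Relation.Binary.Reasoning.Setoid setoid

  -- Leaves one component zero, so that every integer has a single representative. Normal forms are
  -- compared by `refl`, which would tell (2 , 1) from (1 , 0).
  cancel : ℕ → ℕ → ℕ × ℕ
  cancel (suc m) (suc n) = cancel m n
  cancel m       n       = m , n

  -- The pair (m , n) denotes the integer m - n.
  coefficients : RawRing 0ℓ 0ℓ
  coefficients = record
    { Carrier = ℕ × ℕ
    ; _≈_     = _≡_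
    ; _+_     = λ (m , n) (p , q) → cancel (m ℕ.+ p) (n ℕ.+ q)
    ; _*_     = λ (m , n) (p , q) → cancel (m ℕ.* p ℕ.+ n ℕ.* q) (m ℕ.* q ℕ.+ n ℕ.* p)
    ; -_      = λ (m , n) → n , m
    ; 0#      = 0 , 0
    ; 1#      = 1 , 0
    }

  -- The first clause makes the values of 0 and 1 literally 0# and 1#.
  value : ℕ × ℕ → Carrier
  value (m , zero)  = m · 1#
  value (m , suc n) = m · 1# - suc n · 1#

  value-def : ∀ m n → value (m , n) ≈ m · 1# - n · 1#
  value-def m zero    = sym (trans (+-congˡ -0#≈0#) (+-identityʳ _))
  value-def m (suc n) = refl

  interchange : ∀ x y z w → (x + y) + (z + w) ≈ (x + z) + (y + w)
  interchange x y z w = begin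
    (x + y) + (z + w) ≈⟨ +-assoc x y (z + w) ⟩
    x + (y + (z + w)) ≈⟨ +-congˡ (+-assoc y z w) ⟨
    x + ((y + z) + w) ≈⟨ +-congˡ (+-congʳ (+-comm y z)) ⟩
    x + ((z + y) + w) ≈⟨ +-congˡ (+-assoc z y w) ⟩
    x + (z + (y + w)) ≈⟨ +-assoc x z (y + w) ⟨
    (x + z) + (y + w) ∎

  value-cancel : ∀ m n → value (cancel m n) ≈ m · 1# - n · 1#
  value-cancel zero    n       = value-def zero n
  value-cancel (suc m) zero    = value-def (suc m) zero
  value-cancel (suc m) (suc n) = begin
    value (cancel m n)                  ≈⟨ value-cancel m n ⟩
    m · 1# - n · 1#                     ≈⟨ +-identityˡ _ ⟨
    0# + (m · 1# - n · 1#)              ≈⟨ +-congʳ (-‿inverseʳ 1#) ⟨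
    (1# - 1#) + (m · 1# - n · 1#)       ≈⟨ interchange _ _ _ _ ⟩
    (1# + m · 1#) + (- 1# - n · 1#)     ≈⟨ +-congˡ (-‿+-comm 1# (n · 1#)) ⟩
    (1# + m · 1#) - (1# + n · 1#)       ≈⟨ +-cong (×-homo-+ 1# 1 m) (-‿cong (×-homo-+ 1# 1 n)) ⟨
    suc m · 1# - suc n · 1#             ∎

  value-+ : ∀ c d → value (RawRing._+_ coefficients c d) ≈ value c + value d
  value-+ (m , n) (p , q) = begin
    value (cancel (m ℕ.+ p) (n ℕ.+ q))          ≈⟨ value-cancel (m ℕ.+ p) (n ℕ.+ q) ⟩
    (m ℕ.+ p) · 1# - (n ℕ.+ q) · 1#             ≈⟨ +-cong (×-homo-+ 1# m p) (-‿cong (×-homo-+ 1# n q)) ⟩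
    (m · 1# + p · 1#) - (n · 1# + q · 1#)       ≈⟨ +-congˡ (-‿+-comm (n · 1#) (q · 1#)) ⟨
    (m · 1# + p · 1#) + (- (n · 1#) - q · 1#)   ≈⟨ interchange _ _ _ _ ⟩
    (m · 1# - n · 1#) + (p · 1# - q · 1#)       ≈⟨ +-cong (value-def m n) (value-def p q) ⟨
    value (m , n) + value (p , q)               ∎

  value-* : ∀ c d → value (RawRing._*_ coefficients c d) ≈ value c * value d
  value-* (m , n) (p , q) = begin
    value (cancel (m ℕ.* p ℕ.+ n ℕ.* q) (m ℕ.* q ℕ.+ n ℕ.* p))
      ≈⟨ value-cancel (m ℕ.* p ℕ.+ n ℕ.* q) (m ℕ.* q ℕ.+ n ℕ.* p) ⟩
    (m ℕ.* p ℕ.+ n ℕ.* q) · 1# - (m ℕ.* q ℕ.+ n ℕ.* p) · 1#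
      ≈⟨ +-cong (expand m p n q) (-‿cong (expand m q n p)) ⟩
    (M * P + N * Q) - (M * Q + N * P)
      ≈⟨ +-congˡ (-‿+-comm (M * Q) (N * P)) ⟨
    (M * P + N * Q) + (- (M * Q) - N * P)
      ≈⟨ interchange _ _ _ _ ⟩
    (M * P - M * Q) + (N * Q - N * P)
      ≈⟨ +-congˡ (+-comm (N * Q) (- (N * P))) ⟩
    (M * P - M * Q) + (- (N * P) + N * Q)
      ≈⟨ +-cong (+-congˡ (-‿distribʳ-* M Q)) (+-cong (-‿distribˡ-* N P) (minus-minus N Q)) ⟩
    (M * P + M * - Q) + (- N * P + - N * - Q)
      ≈⟨ +-cong (distribˡ M P (- Q)) (distribˡ (- N) P (- Q)) ⟨
    M * (P - Q) + - N * (P - Q)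
      ≈⟨ distribʳ (P - Q) M (- N) ⟨
    (M - N) * (P - Q)
      ≈⟨ *-cong (value-def m n) (value-def p q) ⟨
    value (m , n) * value (p , q) ∎
    where
    M = m · 1#
    N = n · 1#
    P = p · 1#
    Q = q · 1#
    expand : ∀ x y z w → (x ℕ.* y ℕ.+ z ℕ.* w) · 1# ≈ (x · 1#) * (y · 1#) + (z · 1#) * (w · 1#)
    expand x y z w = trans (×-homo-+ 1# (x ℕ.* y) (z ℕ.* w)) (+-cong (×1-homo-* x y) (×1-homo-* z w))
    minus-minus : ∀ x y → x * y ≈ - x * - y
    minus-minus x y = begin
      x * y         ≈⟨ -‿involutive (x * y) ⟨
      - - (x * y)   ≈⟨ -‿cong (-‿distribʳ-* x y) ⟩
      - (x * - y)   ≈⟨ -‿distribˡ-* x (- y) ⟩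
      - x * - y     ∎

  value-neg : ∀ c → value (RawRing.-_ coefficients c) ≈ - value c
  value-neg (m , n) = begin
    value (n , m)            ≈⟨ value-def n m ⟩
    n · 1# - m · 1#          ≈⟨ +-comm _ _ ⟩
    - (m · 1#) + n · 1#      ≈⟨ +-congˡ (-‿involutive _) ⟨
    - (m · 1#) - - (n · 1#)  ≈⟨ -‿+-comm _ _ ⟩
    - (m · 1# - n · 1#)      ≈⟨ -‿cong (value-def m n) ⟨
    - value (m , n)          ∎

  homomorphism : coefficients -Raw-AlmostCommutative⟶ fromCommutativeRing R
  homomorphism = record
    { ⟦_⟧    = value
    ; +-homo = value-+
    ; *-homo = value-*
    ; -‿homo = value-neg
    ; 0-homo = refl
    ; 1-homo = refl
    }

  value-≟ : WeaklyDecidable (Induced-equivalence homomorphism)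
  value-≟ (m , n) (p , q) with (m ℕ.+ q) ℕ.≟ (p ℕ.+ n)
  ... | no  _  = nothing
  ... | yes eq = just (begin
    value (m , n)                      ≈⟨ +-identityʳ _ ⟨
    value (m , n) + 0#                 ≈⟨ +-congˡ (-‿inverseʳ (q · 1#)) ⟨
    value (m , n) + (q · 1# - q · 1#)  ≈⟨ +-congʳ (value-def m n) ⟩
    (m · 1# - n · 1#) + (q · 1# - q · 1#) ≈⟨ interchange _ _ _ _ ⟩
    (m · 1# + q · 1#) + (- (n · 1#) - q · 1#) ≈⟨ +-congʳ (×-homo-+ 1# m q) ⟨
    (m ℕ.+ q) · 1# + (- (n · 1#) - q · 1#)    ≈⟨ +-cong (reflexive (≡.cong (_· 1#) eq)) (+-comm _ _) ⟩
    (p ℕ.+ n) · 1# + (- (q · 1#) - n · 1#)    ≈⟨ +-congʳ (×-homo-+ 1# p n) ⟩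
    (p · 1# + n · 1#) + (- (q · 1#) - n · 1#) ≈⟨ interchange _ _ _ _ ⟩
    (p · 1# - q · 1#) + (n · 1# - n · 1#)     ≈⟨ +-congˡ (-‿inverseʳ (n · 1#)) ⟩
    (p · 1# - q · 1#) + 0#                    ≈⟨ +-identityʳ _ ⟩
    p · 1# - q · 1#                           ≈⟨ value-def p q ⟨
    value (p , q)                      ∎)

  open Algebra.Solver.Ring coefficients (fromCommutativeRing R) homomorphism value-≟ public
    using (solve; _:=_; _:+_; _:*_; _:-_; :-_; con)

-- Arithmetic in an ordered field

module OrderedField {a ℓ₁ ℓ₂} (R : Reals a ℓ₁ ℓ₂) where

  open Reals R public
  open Spanners R using (fromℕ) public
  open CommutativeRing commutativeRing public using
    ( refl; sym; trans; reflexive; semiring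
    ; +-cong; +-congˡ; +-congʳ; *-cong; *-congˡ; *-congʳ; -‿cong
    ; +-assoc; +-comm; +-identityˡ; +-identityʳ; -‿inverseʳ
    ; *-assoc; *-comm; *-identityˡ; *-identityʳ; zeroˡ; zeroʳ )
  open IsDecTotalOrder isDecTotalOrder public
    using (total; antisym; isPartialOrder; _≟_)
    renaming (refl to ≤-refl; reflexive to ≤-reflexive; trans to ≤-trans; ≤-respˡ-≈ to ≤-respˡ; ≤-respʳ-≈ to ≤-respʳ)
  open IntegerRingSolver commutativeRing public
    using (solve; _:=_; _:+_; _:*_; _:-_; :-_; con)

  poset : Poset a ℓ₁ ℓ₂
  poset = record { isPartialOrder = isPartialOrder }

  module ≤-Reasoning = Relation.Binary.Reasoning.PartialOrder poset

  open Algebra.Properties.Semiring.Mult semiring using (×1-homo-*)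

  sq : Carrier → Carrier
  sq x = x * x

  sq-cong : ∀ {x y} → x ≈ y → sq x ≈ sq y
  sq-cong eq = *-cong eq eq

  +-monoʳ-≤ : ∀ z {x y} → x ≤ y → z + x ≤ z + y
  +-monoʳ-≤ z x≤y = ≤-respˡ (+-comm _ z) (≤-respʳ (+-comm _ z) (+-monoˡ-≤ z x≤y))

  +-mono-≤ : ∀ {x y u v} → x ≤ y → u ≤ v → x + u ≤ y + v
  +-mono-≤ x≤y u≤v = ≤-trans (+-monoˡ-≤ _ x≤y) (+-monoʳ-≤ _ u≤v)

  x≤y⇒0≤y-x : ∀ {x y} → x ≤ y → 0# ≤ y - x
  x≤y⇒0≤y-x {x} x≤y = ≤-respˡ (-‿inverseʳ x) (+-monoˡ-≤ (- x) x≤y)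

  0≤y-x⇒x≤y : ∀ {x y} → 0# ≤ y - x → x ≤ y
  0≤y-x⇒x≤y {x} {y} h = ≤-respˡ (+-identityˡ x)
    (≤-respʳ (solve 2 (λ x y → (y :- x) :+ x := y) refl x y) (+-monoˡ-≤ x h))

  x≤x+y : ∀ {x y} → 0# ≤ y → x ≤ x + y
  x≤x+y {x} h = ≤-respˡ (+-identityʳ x) (+-monoʳ-≤ x h)

  +-nonNegative : ∀ {x y} → 0# ≤ x → 0# ≤ y → 0# ≤ x + y
  +-nonNegative 0≤x 0≤y = ≤-trans 0≤x (x≤x+y 0≤y)

  *-monoˡ-≤ : ∀ {z x y} → 0# ≤ z → x ≤ y → z * x ≤ z * y
  *-monoˡ-≤ {z} {x} {y} 0≤z x≤y = 0≤y-x⇒x≤y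
    (≤-respʳ (solve 3 (λ x y z → z :* (y :- x) := z :* y :- z :* x) refl x y z)
      (*-nonNegative 0≤z (x≤y⇒0≤y-x x≤y)))

  *-mono-≤ : ∀ {x y u v} → 0# ≤ u → 0# ≤ y → x ≤ y → u ≤ v → x * u ≤ y * v
  *-mono-≤ {x} {y} {u} {v} 0≤u 0≤y x≤y u≤v = ≤-trans
    (≤-respˡ (*-comm u x) (≤-respʳ (*-comm u y) (*-monoˡ-≤ 0≤u x≤y)))
    (*-monoˡ-≤ 0≤y u≤v)

  sq-nonNegative : ∀ x → 0# ≤ sq x
  sq-nonNegative x with total 0# x
  ... | inj₁ 0≤x = *-nonNegative 0≤x 0≤x
  ... | inj₂ x≤0 = ≤-respʳ (solve 1 (λ x → (con (0 , 0) :- x) :* (con (0 , 0) :- x) := x :* x) refl x)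
                     (*-nonNegative (x≤y⇒0≤y-x x≤0) (x≤y⇒0≤y-x x≤0))

  0≤1 : 0# ≤ 1#
  0≤1 = ≤-respʳ (*-identityˡ 1#) (sq-nonNegative 1#)

  1≰0 : ¬ (1# ≤ 0#)
  1≰0 1≤0 = 0≉1 (antisym 0≤1 1≤0)

  ≰⇒≥ : ∀ {x y} → ¬ (x ≤ y) → y ≤ x
  ≰⇒≥ {x} {y} x≰y with total x y
  ... | inj₁ x≤y = ⊥-elim (x≰y x≤y)
  ... | inj₂ y≤x = y≤x

  1≤⇒0≤ : ∀ {x} → 1# ≤ x → 0# ≤ x
  1≤⇒0≤ = ≤-trans 0≤1

  1≤⇒≉0 : ∀ {x} → 1# ≤ x → ¬ (x ≈ 0#)
  1≤⇒≉0 1≤x x≈0 = 1≰0 (≤-respʳ x≈0 1≤x)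

  1≤⇒inverse : ∀ {x} → 1# ≤ x → x * x ⁻¹ ≈ 1#
  1≤⇒inverse 1≤x = ⁻¹-inverseʳ (1≤⇒≉0 1≤x)

  -- `x ⁻¹` equals `x * sq (x ⁻¹)`, a product of nonnegative factors.
  1≤⇒0≤⁻¹ : ∀ {x} → 1# ≤ x → 0# ≤ x ⁻¹
  1≤⇒0≤⁻¹ {x} 1≤x = ≤-respʳ
    (trans (sym (*-assoc x (x ⁻¹) (x ⁻¹))) (trans (*-congʳ (1≤⇒inverse 1≤x)) (*-identityˡ _)))
    (*-nonNegative (1≤⇒0≤ 1≤x) (sq-nonNegative (x ⁻¹)))

  no-zero-divisor : ∀ {x y} → ¬ (x ≈ 0#) → x * y ≈ 0# → y ≈ 0#
  no-zero-divisor {x} {y} x≉0 xy≈0 = begin-equality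
    y              ≈⟨ *-identityˡ y ⟨
    1# * y         ≈⟨ *-congʳ (⁻¹-inverseʳ x≉0) ⟨
    x * x ⁻¹ * y   ≈⟨ solve 3 (λ x i y → x :* i :* y := i :* (x :* y)) refl x (x ⁻¹) y ⟩
    x ⁻¹ * (x * y) ≈⟨ *-congˡ xy≈0 ⟩
    x ⁻¹ * 0#      ≈⟨ zeroʳ _ ⟩
    0#             ∎
    where open ≤-Reasoning

  sq≤0⇒≈0 : ∀ {x} → sq x ≤ 0# → x ≈ 0#
  sq≤0⇒≈0 {x} h with x ≟ 0#
  ... | yes x≈0 = x≈0
  ... | no  x≉0 = no-zero-divisor x≉0 (antisym h (sq-nonNegative x))

  fromℕ-nonNegative : ∀ n → 0# ≤ fromℕ n
  fromℕ-nonNegative zero    = ≤-refl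
  fromℕ-nonNegative (suc n) = +-nonNegative 0≤1 (fromℕ-nonNegative n)

  fromℕ-mono : ∀ {m n} → m ℕ.≤ n → fromℕ m ≤ fromℕ n
  fromℕ-mono {n = n} z≤n = fromℕ-nonNegative n
  fromℕ-mono (s≤s m≤n)   = +-monoʳ-≤ 1# (fromℕ-mono m≤n)

  -- Cardinalities and powers of two are compared inside the field; this brings the outcome back to
  -- ℕ.
  fromℕ-reflects-≤ : ∀ m n → fromℕ m ≤ fromℕ n → m ℕ.≤ n
  fromℕ-reflects-≤ zero    n       h = z≤n
  fromℕ-reflects-≤ (suc m) zero    h = ⊥-elim (1≰0 (≤-trans (x≤x+y (fromℕ-nonNegative m)) h))
  fromℕ-reflects-≤ (suc m) (suc n) h = s≤s (fromℕ-reflects-≤ m n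
    (≤-respˡ (cancel (fromℕ m)) (≤-respʳ (cancel (fromℕ n)) (+-monoˡ-≤ (- 1#) h))))
    where
    cancel : ∀ x → 1# + x - 1# ≈ x
    cancel x = solve 1 (λ x → con (1 , 0) :+ x :- con (1 , 0) := x) refl x

  fromℕ-* : ∀ m n → fromℕ (m ℕ.* n) ≈ fromℕ m * fromℕ n
  fromℕ-* = ×1-homo-*

  fromℕ-1 : fromℕ 1 ≈ 1#
  fromℕ-1 = +-identityʳ 1#

-- Finite sums and products

module Sums {a ℓ₁ ℓ₂} (R : Reals a ℓ₁ ℓ₂) where

  open OrderedField R
  open Algebra.Properties.Semiring.Sum semiring
    using (sum; sum-cong-≋; ∑-distrib-+; *-distribˡ-sum; sum-replicate-zero)

  -- Summands are indexed by ℕ and cut off at the first argument, like the arrays of a program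
  -- state, which can then be summed without conversion to `Fin`.
  S : ℕ → (ℕ → Carrier) → Carrier
  S zero    f = 0#
  S (suc n) f = f 0 + S n (f ∘ suc)

  S≡sum : ∀ n f → S n f ≡ sum {n} (f ∘ toℕ)
  S≡sum zero    f = ≡.refl
  S≡sum (suc n) f = ≡.cong (f 0 +_) (S≡sum n (f ∘ suc))

  S-cong : ∀ n {f g} → (∀ i → i ℕ.< n → f i ≈ g i) → S n f ≈ S n g
  S-cong zero    f≈g = refl
  S-cong (suc n) f≈g = +-cong (f≈g 0 (s≤s z≤n)) (S-cong n (λ i i<n → f≈g (suc i) (s≤s i<n)))

  S-mono : ∀ n {f g} → (∀ i → i ℕ.< n → f i ≤ g i) → S n f ≤ S n g
  S-mono zero    f≤g = ≤-refl
  S-mono (suc n) f≤g = +-mono-≤ (f≤g 0 (s≤s z≤n)) (S-mono n (λ i i<n → f≤g (suc i) (s≤s i<n)))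

  S-zero : ∀ n {f} → (∀ i → i ℕ.< n → f i ≈ 0#) → S n f ≈ 0#
  S-zero n {f} f≈0 = trans (reflexive (S≡sum n f))
    (trans (sum-cong-≋ (λ i → f≈0 (toℕ i) (Fin.toℕ<n i))) (sum-replicate-zero n))

  S-nonNegative : ∀ n {f} → (∀ i → i ℕ.< n → 0# ≤ f i) → 0# ≤ S n f
  S-nonNegative n 0≤f = ≤-respˡ (S-zero n (λ _ _ → refl)) (S-mono n 0≤f)

  S-+ : ∀ n f g → S n (λ i → f i + g i) ≈ S n f + S n g
  S-+ n f g = begin-equality
    S n (λ i → f i + g i)                 ≡⟨ S≡sum n _ ⟩
    sum {n} (λ i → f (toℕ i) + g (toℕ i))     ≈⟨ ∑-distrib-+ {n} (f ∘ toℕ) (g ∘ toℕ) ⟩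
    sum {n} (f ∘ toℕ) + sum {n} (g ∘ toℕ)         ≡⟨ ≡.cong₂ _+_ (S≡sum n f) (S≡sum n g) ⟨
    S n f + S n g                         ∎
    where open ≤-Reasoning

  S-* : ∀ n c f → S n (λ i → c * f i) ≈ c * S n f
  S-* n c f = begin-equality
    S n (λ i → c * f i)           ≡⟨ S≡sum n _ ⟩
    sum {n} (λ i → c * f (toℕ i)) ≈⟨ *-distribˡ-sum {n} c (f ∘ toℕ) ⟨
    c * sum {n} (f ∘ toℕ)             ≡⟨ ≡.cong (c *_) (S≡sum n f) ⟨
    c * S n f                     ∎
    where open ≤-Reasoning

  S-update : ∀ n k {f f′ c} → k ℕ.< n → f′ k ≈ f k + c → (∀ i → i ≢ k → f′ i ≈ f i) →
             S n f′ ≈ S n f + c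
  S-update (suc n) zero {f} {f′} {c} _ hit miss = begin-equality
    f′ 0 + S n (f′ ∘ suc)     ≈⟨ +-cong hit (S-cong n (λ i _ → miss (suc i) (λ ()))) ⟩
    (f 0 + c) + S n (f ∘ suc) ≈⟨ solve 3 (λ x c y → (x :+ c) :+ y := (x :+ y) :+ c) refl _ _ _ ⟩
    (f 0 + S n (f ∘ suc)) + c ∎
    where open ≤-Reasoning
  S-update (suc n) (suc k) {f} {f′} {c} (s≤s k<n) hit miss = trans
    (+-cong (miss 0 (λ ()))
      (S-update n k k<n hit (λ i i≢k → miss (suc i) (i≢k ∘ ℕ.suc-injective))))
    (sym (+-assoc _ _ _))

  S-single : ∀ n k {f} → k ℕ.< n → (∀ i → i ≢ k → f i ≈ 0#) → S n f ≈ f k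
  S-single n k {f} k<n miss = begin-equality
    S n f                  ≈⟨ S-update n k {f = λ _ → 0#} k<n (sym (+-identityˡ _)) miss ⟩
    S n (λ _ → 0#) + f k   ≈⟨ +-congʳ (S-zero n (λ _ _ → refl)) ⟩
    0# + f k               ≈⟨ +-identityˡ _ ⟩
    f k                    ∎
    where open ≤-Reasoning

  S-term-≤ : ∀ n k {f} → k ℕ.< n → (∀ i → i ℕ.< n → 0# ≤ f i) → f k ≤ S n f
  S-term-≤ (suc n) zero    _         0≤f = x≤x+y (S-nonNegative n (λ i i<n → 0≤f (suc i) (s≤s i<n)))
  S-term-≤ (suc n) (suc k) (s≤s k<n) 0≤f = ≤-respˡ (+-identityˡ _)
    (+-mono-≤ (0≤f 0 (s≤s z≤n)) (S-term-≤ n k k<n (λ i i<n → 0≤f (suc i) (s≤s i<n))))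

  -- A potential `z` turns an identity at each index into one between sums. The rank-one update
  -- takes as potentials the pivot sums, the tails `s`, the products `- (c k * s k)` and the
  -- quotients `sq (s k) * t k ⁻¹`.
  S-telescope : ∀ n {f g z : ℕ → Carrier} → (∀ i → i ℕ.< n → f i + z (suc i) ≈ g i + z i) →
                S n f + z n ≈ S n g + z 0
  S-telescope zero step = refl
  S-telescope (suc n) {f} {g} {z} step = begin-equality
    (f 0 + S n (f ∘ suc)) + z (suc n) ≈⟨ +-assoc _ _ _ ⟩
    f 0 + (S n (f ∘ suc) + z (suc n)) ≈⟨ +-congˡ (S-telescope n {z = z ∘ suc} (λ i i<n → step (suc i) (s≤s i<n))) ⟩
    f 0 + (S n (g ∘ suc) + z 1)       ≈⟨ solve 3 (λ x y w → x :+ (y :+ w) := (x :+ w) :+ y) refl _ _ _ ⟩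
    (f 0 + z 1) + S n (g ∘ suc)       ≈⟨ +-congʳ (step 0 (s≤s z≤n)) ⟩
    (g 0 + z 0) + S n (g ∘ suc)       ≈⟨ solve 3 (λ x y w → (x :+ w) :+ y := (x :+ y) :+ w) refl _ _ _ ⟩
    (g 0 + S n (g ∘ suc)) + z 0       ∎
    where open ≤-Reasoning

  Π : ℕ → (ℕ → Carrier) → Carrier
  Π zero    f = 1#
  Π (suc n) f = f 0 * Π n (f ∘ suc)

  Π-telescope : ∀ n {f g z : ℕ → Carrier} → (∀ i → i ℕ.< n → f i * z i ≈ g i * z (suc i)) →
                Π n f * z 0 ≈ Π n g * z n
  Π-telescope zero step = refl
  Π-telescope (suc n) {f} {g} {z} step = begin-equality
    f 0 * Π n (f ∘ suc) * z 0       ≈⟨ solve 3 (λ x y w → x :* y :* w := (x :* w) :* y) refl _ _ _ ⟩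
    (f 0 * z 0) * Π n (f ∘ suc)     ≈⟨ *-congʳ (step 0 (s≤s z≤n)) ⟩
    (g 0 * z 1) * Π n (f ∘ suc)     ≈⟨ solve 3 (λ x y w → x :* y :* w := x :* (w :* y)) refl _ _ _ ⟩
    g 0 * (Π n (f ∘ suc) * z 1)     ≈⟨ *-congˡ (Π-telescope n {z = z ∘ suc} (λ i i<n → step (suc i) (s≤s i<n))) ⟩
    g 0 * (Π n (g ∘ suc) * z (suc n)) ≈⟨ *-assoc _ _ _ ⟨
    g 0 * Π n (g ∘ suc) * z (suc n) ∎
    where open ≤-Reasoning

  Π-bound : ∀ n {f} N → (∀ i → i ℕ.< n → 0# ≤ f i × f i ≤ fromℕ N) → 0# ≤ Π n f × Π n f ≤ fromℕ (N ℕ.^ n)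
  Π-bound zero    N h = 0≤1 , ≤-reflexive (sym fromℕ-1)
  Π-bound (suc n) N h with h 0 (s≤s z≤n) | Π-bound n N (λ i i<n → h (suc i) (s≤s i<n))
  ... | 0≤f , f≤N | 0≤Π , Π≤N = *-nonNegative 0≤f 0≤Π ,
    ≤-respʳ (sym (fromℕ-* N (N ℕ.^ n))) (*-mono-≤ 0≤Π (fromℕ-nonNegative N) f≤N Π≤N)

-- Why 2^N ≤ (4 N)^d fails at N = 8 d (1 + log d)

module Counting where
  open import Data.Nat

  n<2^n : ∀ n → n < 2 ^ n
  n<2^n zero    = s≤s z≤n
  n<2^n (suc n) = begin
    2 + n             ≤⟨ ℕ.+-mono-≤ (ℕ.≤-trans (s≤s z≤n) (n<2^n n)) (n<2^n n) ⟩
    2 ^ n + 2 ^ n     ≡⟨ ≡.cong (2 ^ n +_) (ℕ.+-identityʳ (2 ^ n)) ⟨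
    2 ^ suc n         ∎
    where open ℕ.≤-Reasoning

  n<2^[1+log₂n] : ∀ n → n < 2 ^ suc ⌊log₂ n ⌋
  n<2^[1+log₂n] n = ℕ.≰⇒> λ h → ℕ.<-irrefl ≡.refl
    (≡.subst (_≤ ⌊log₂ n ⌋) (⌊log₂[2^n]⌋≡n (suc ⌊log₂ n ⌋)) (⌊log₂⌋-mono-≤ h))

  bound : ℕ → ℕ
  bound = Õ 8 1

  d+1<bound : ∀ d → 1 ≤ d → suc d < bound d
  d+1<bound d 1≤d = begin
    2 + d                      ≤⟨ ℕ.+-monoˡ-≤ d (ℕ.*-monoʳ-≤ 2 1≤d) ⟩
    2 * d + d                  ≤⟨ ℕ.m≤m+n _ (5 * d) ⟩
    2 * d + d + 5 * d          ≡⟨ solve 1 (λ x → con 2 :* x :+ x :+ con 5 :* x := con 8 :* x :* con 1) ≡.refl d ⟩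
    8 * d * 1                  ≤⟨ ℕ.*-monoʳ-≤ (8 * d) (ℕ.m^n>0 (suc ⌊log₂ d ⌋) 1) ⟩
    bound d                    ∎
    where open ℕ.≤-Reasoning
          open +-*-Solver

  -- Both sides are d-th powers, so their roots are compared. With m = 1 + ⌊log₂ d⌋ this is 32 d m <
  -- 32 · 2^m · 2^m = 2^(5 + 2m) ≤ 2^(8m), where d and m are both below 2^m and 5 ≤ 6m.
  2^bound>[4bound]^d : ∀ d → 1 ≤ d → ¬ (2 ^ bound d ≤ (4 * bound d) ^ d)
  2^bound>[4bound]^d d@(suc _) 1≤d h = ℕ.<⇒≱ 4b<2^8m (root-≤ h′)
    where
    open ℕ.≤-Reasoning
    open +-*-Solver using (solve; con; _:+_; _:*_; _:=_)
    m = suc ⌊log₂ d ⌋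
    root-≤ : (2 ^ (8 * m)) ^ d ≤ (4 * bound d) ^ d → 2 ^ (8 * m) ≤ 4 * bound d
    root-≤ h = ℕ.≮⇒≥ λ lt → ℕ.<⇒≱ (ℕ.^-monoˡ-< d lt) h
    h′ : (2 ^ (8 * m)) ^ d ≤ (4 * bound d) ^ d
    h′ = begin
      (2 ^ (8 * m)) ^ d   ≡⟨ ℕ.^-*-assoc 2 (8 * m) d ⟩
      2 ^ (8 * m * d)     ≡⟨ ≡.cong (2 ^_) (solve 2 (λ m d → con 8 :* m :* d := con 8 :* d :* (m :* con 1)) ≡.refl m d) ⟩
      2 ^ bound d         ≤⟨ h ⟩
      (4 * bound d) ^ d   ∎
    4b<2^8m : 4 * bound d < 2 ^ (8 * m)
    4b<2^8m = begin-strict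
      4 * bound d               ≡⟨ solve 2 (λ m d → con 4 :* (con 8 :* d :* (m :* con 1)) := con 32 :* (d :* m)) ≡.refl m d ⟩
      32 * (d * m)              <⟨ ℕ.*-monoʳ-< 32 (ℕ.*-mono-< (n<2^[1+log₂n] d) (n<2^n m)) ⟩
      32 * (2 ^ m * 2 ^ m)      ≡⟨ ≡.cong (32 *_) (ℕ.^-distribˡ-+-* 2 m m) ⟨
      32 * 2 ^ (m + m)          ≡⟨ ℕ.^-distribˡ-+-* 2 5 (m + m) ⟨
      2 ^ (5 + (m + m))         ≤⟨ ℕ.^-monoʳ-≤ 2 (ℕ.+-monoˡ-≤ (m + m) (ℕ.≤-trans (ℕ.m≤m+n 5 1) (ℕ.*-monoʳ-≤ 6 {1} {m} (s≤s z≤n)))) ⟩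
      2 ^ (6 * m + (m + m))     ≡⟨ ≡.cong (2 ^_) (solve 1 (λ m → con 6 :* m :+ (m :+ m) := con 8 :* m) ≡.refl m) ⟩
      2 ^ (8 * m)               ∎

-- Functionals, the quadratic form of a multiset, and coordinate changes

module Coordinates {a ℓ₁ ℓ₂} (R : Reals a ℓ₁ ℓ₂) (d n : ℕ) where

  open OrderedField R public
  open Sums R public

  Seq : Set a
  Seq = ℕ → Carrier

  Rows : Set a
  Rows = ℕ → Seq

  dot : Seq → Seq → Carrier
  dot g w = S d (λ j → g j * w j)

  dot-congʳ : ∀ g {w w′} → (∀ j → j ℕ.< d → w j ≈ w′ j) → dot g w ≈ dot g w′
  dot-congʳ g eq = S-cong d (λ j j<d → *-congˡ (eq j j<d))

  -- This is gᵀ M g for M = Σ_v m_v W_v W_vᵀ, where `m` gives the multiplicities of the multiset U.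
  -- The matrix itself never appears.
  form : (ℕ → ℕ) → Rows → Seq → Carrier
  form m W g = S n (λ v → fromℕ (m v) * sq (dot g (W v)))

  form-cong : ∀ m {W W′ g g′} → (∀ v → v ℕ.< n → dot g (W v) ≈ dot g′ (W′ v)) →
              form m W g ≈ form m W′ g′
  form-cong m eq = S-cong n (λ v v<n → *-congˡ (sq-cong (eq v v<n)))

  Increments : ℕ → (m m′ : ℕ → ℕ) → Set
  Increments b m m′ = m′ b ≡ suc (m b) × (∀ v → v ≢ b → m′ v ≡ m v)

  form-increment : ∀ {b m m′} → b ℕ.< n → Increments b m m′ → ∀ W g →
                   form m′ W g ≈ form m W g + sq (dot g (W b))
  form-increment {b} {m} {m′} b<n (hit , miss) W g = S-update n b b<n
    (trans (*-congʳ (reflexive (≡.cong fromℕ hit)))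
      (solve 2 (λ c x → (con (1 , 0) :+ c) :* x := c :* x :+ x) refl (fromℕ (m b)) _))
    (λ v v≢b → *-congʳ (reflexive (≡.cong fromℕ (miss v v≢b))))

  form-increment-≤ : ∀ {b m m′} → b ℕ.< n → Increments b m m′ → ∀ W g → form m W g ≤ form m′ W g
  form-increment-≤ b<n inc W g = ≤-respʳ (sym (form-increment b<n inc W g)) (x≤x+y (sq-nonNegative _))

  Size : (ℕ → ℕ) → ℕ → Set ℓ₁
  Size m N = S n (fromℕ ∘ m) ≈ fromℕ N

  Size-increment : ∀ {b m m′ N} → b ℕ.< n → Increments b m m′ → Size m N → Size m′ (suc N)
  Size-increment {b} {m} {m′} {N} b<n (hit , miss) size = begin-equality
    S n (fromℕ ∘ m′)     ≈⟨ S-update n b b<n (trans (reflexive (≡.cong fromℕ hit)) (+-comm _ _))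
                              (λ v v≢b → reflexive (≡.cong fromℕ (miss v v≢b))) ⟩
    S n (fromℕ ∘ m) + 1# ≈⟨ +-comm _ _ ⟩
    1# + S n (fromℕ ∘ m) ≈⟨ +-congˡ size ⟩
    1# + fromℕ N         ∎
    where open ≤-Reasoning

  -- The relation W_v W_vᵀ ⪯ M, tested on functionals. No inverse occurs, so a singular M needs no
  -- special treatment.
  Covered : (ℕ → ℕ) → Rows → ℕ → Set (a ⊔ ℓ₂)
  Covered m W v = ∀ g → sq (dot g (W v)) ≤ form m W g

  Dominated : Seq → (ℕ → ℕ) → Rows → Set (a ⊔ ℓ₂)
  Dominated D m W = ∀ g → S d (λ j → D j * sq (g j)) ≤ form m W g

  -- Coordinate changes are recorded through their action on functionals, so
  -- the matrix of the change of basis is never needed.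
  Spans : Rows → Rows → Set (a ⊔ ℓ₁)
  Spans V W = ∀ x → Σ[ g ∈ Seq ] (∀ v → v ℕ.< n → dot x (V v) ≈ dot g (W v))

  -- diag(D) is a lower bound for Σ_v m_v v vᵀ in the current coordinates. E
  -- agrees with D except that it is 1 on the columns where all rows vanish, so
  -- that the product of E stands for the determinant.
  Inactive : Rows → Seq → Seq → ℕ → Set ℓ₁
  Inactive W D E j = D j ≈ 0# × E j ≈ 1# × (∀ v → v ℕ.< n → W v j ≈ 0#)

  -- Entries of a processed column may leave [-1, 1] under later coordinate changes; `functional`
  -- still reads off the coordinate that was in the box. `triangular` protects `diagonal`: an update
  -- adds to coefficient j only a multiple of a combination of the coefficients behind j, and these
  -- vanish.
  record Active (W : Rows) (D E : Seq) (j : ℕ) : Set (a ⊔ ℓ₁ ⊔ ℓ₂) where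
    field
      weight      : D j ≈ E j
      1≤weight    : 1# ≤ E j
      functional  : Seq
      diagonal    : functional j ≈ 1#
      triangular  : ∀ k → j ℕ.< k → k ℕ.< d → functional k ≈ 0#
      box         : ∀ v → v ℕ.< n → sq (dot functional (W v)) ≤ 1#

  Column : Rows → Seq → Seq → ℕ → Set (a ⊔ ℓ₁ ⊔ ℓ₂)
  Column W D E j = Inactive W D E j ⊎ Active W D E j

  column-weight : ∀ {W D E j} → Column W D E j → D j ≈ 0# ⊎ (1# ≤ D j)
  column-weight (inj₁ (D≈0 , _))  = inj₁ D≈0
  column-weight (inj₂ c) = inj₂ (≤-respʳ (sym (Active.weight c)) (Active.1≤weight c))

  D-nonNegative : ∀ {x} → x ≈ 0# ⊎ (1# ≤ x) → 0# ≤ x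
  D-nonNegative (inj₁ eq) = ≤-reflexive (sym eq)
  D-nonNegative (inj₂ h)  = 1≤⇒0≤ h

  -- Evaluate the dominated form at the functional of an active column.
  column-bound : ∀ {W D E m N} → (∀ j → j ℕ.< d → Column W D E j) → Dominated D m W → Size m N → 1 ℕ.≤ N →
                 ∀ j → j ℕ.< d → 0# ≤ E j × E j ≤ fromℕ N
  column-bound {N = N} cols dom size 1≤N j j<d with cols j j<d
  ... | inj₁ (_ , E≈1 , _) =
    ≤-respʳ (sym E≈1) 0≤1 , ≤-respˡ (trans fromℕ-1 (sym E≈1)) (fromℕ-mono 1≤N)
  column-bound {W} {D} {E} {m} {N} cols dom size 1≤N j j<d | inj₂ c = 1≤⇒0≤ 1≤weight , (begin
    E j                                       ≈⟨ weight ⟨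
    D j                                       ≈⟨ *-identityʳ _ ⟨
    D j * 1#                                  ≈⟨ *-congˡ (trans (sq-cong diagonal) (*-identityˡ 1#)) ⟨
    D j * sq (g j)                            ≤⟨ S-term-≤ d j j<d (λ k k<d →
                                                   *-nonNegative (D-nonNegative (column-weight (cols k k<d))) (sq-nonNegative _)) ⟩
    S d (λ k → D k * sq (g k))                ≤⟨ dom g ⟩
    form m W g                                ≤⟨ S-mono n (λ v v<n → *-monoˡ-≤ (fromℕ-nonNegative (m v)) (box v v<n)) ⟩
    S n (λ v → fromℕ (m v) * 1#)              ≈⟨ S-cong n (λ v _ → *-identityʳ _) ⟩
    S n (fromℕ ∘ m)                           ≈⟨ size ⟩
    fromℕ N                                   ∎)
    where
    open ≤-Reasoning
    open Active c renaming (functional to g)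

  -- Both maps act on functionals: forth is the adjoint of the coordinate
  -- change from W′ to W, and back its inverse.
  record Transform (W W′ : Rows) : Set (a ⊔ ℓ₁) where
    field
      forth     : Seq → Seq
      forth-dot : ∀ g v → v ℕ.< n → dot g (W v) ≈ dot (forth g) (W′ v)
      back      : Seq → Seq
      back-dot  : ∀ g v → v ℕ.< n → dot (back g) (W v) ≈ dot g (W′ v)

    spans : ∀ {V} → Spans V W → Spans V W′
    spans sp x = forth (proj₁ (sp x)) , λ v v<n → trans (proj₂ (sp x) v v<n) (forth-dot _ v v<n)

    back-form : ∀ m g → form m W (back g) ≈ form m W′ g
    back-form m g = form-cong m (back-dot g)

    covered : ∀ {m v} → v ℕ.< n → Covered m W v → Covered m W′ v
    covered {m} v<n cov g = ≤-respˡ (sq-cong (back-dot g _ v<n)) (≤-respʳ (back-form m g) (cov (back g)))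

-- Gaussian elimination with the largest pivot of each column

module Elimination {a ℓ₁ ℓ₂} (R : Reals a ℓ₁ ℓ₂) (d n : ℕ) where

  open Coordinates R d n

  δ : ℕ → ℕ → Carrier
  δ k j with j ℕ.≟ k
  ... | yes _ = 1#
  ... | no  _ = 0#

  δ-diagonal : ∀ k → δ k k ≡ 1#
  δ-diagonal k with k ℕ.≟ k
  ... | yes _   = ≡.refl
  ... | no  k≢k = ⊥-elim (k≢k ≡.refl)

  δ-off : ∀ {k j} → j ≢ k → δ k j ≡ 0#
  δ-off {k} {j} j≢k with j ℕ.≟ k
  ... | yes eq = ⊥-elim (j≢k eq)
  ... | no  _  = ≡.refl

  dot-δ : ∀ g k → k ℕ.< d → dot g (δ k) ≈ g k
  dot-δ g k k<d = trans
    (S-single d k k<d (λ j j≢k → trans (*-congˡ (reflexive (δ-off j≢k))) (zeroʳ _)))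
    (trans (*-congˡ (reflexive (δ-diagonal k))) (*-identityʳ _))

  δ-dot : ∀ w k → k ℕ.< d → dot (δ k) w ≈ w k
  δ-dot w k k<d = trans (S-cong d (λ j _ → *-comm _ _)) (dot-δ w k k<d)

  _⊹_∙δ_ : Seq → Carrier → ℕ → Seq
  (g ⊹ γ ∙δ k) j = g j + γ * δ k j

  ⊹-off : ∀ g γ {k j} → j ≢ k → (g ⊹ γ ∙δ k) j ≈ g j
  ⊹-off g γ j≢k = trans (+-congˡ (trans (*-congˡ (reflexive (δ-off j≢k))) (zeroʳ γ))) (+-identityʳ _)

  dot-⊹ : ∀ g γ k w → k ℕ.< d → dot (g ⊹ γ ∙δ k) w ≈ dot g w + γ * w k
  dot-⊹ g γ k w k<d = begin-equality
    S d (λ j → (g j + γ * δ k j) * w j)               ≈⟨ S-cong d (λ j _ → solve 4 (λ g c e w → (g :+ c :* e) :* w := g :* w :+ c :* (e :* w)) refl (g j) γ (δ k j) (w j)) ⟩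
    S d (λ j → g j * w j + γ * (δ k j * w j))         ≈⟨ S-+ d _ _ ⟩
    dot g w + S d (λ j → γ * (δ k j * w j))           ≈⟨ +-congˡ (S-* d γ _) ⟩
    dot g w + γ * dot (δ k) w                         ≈⟨ +-congˡ (*-congˡ (δ-dot w k k<d)) ⟩
    dot g w + γ * w k                                 ∎
    where open ≤-Reasoning

  -- After i steps the columns k with d ≤ k + i have been processed. In this
  -- order, eliminating column k changes the functional of a processed column
  -- j > k at index k only, which keeps it triangular.
  record Phase1 (V : Rows) (i : ℕ) (W : Rows) (D : Seq) (m : ℕ → ℕ) : Set (a ⊔ ℓ₁ ⊔ ℓ₂) where
    field
      N         : ℕ
      1≤N       : 1 ℕ.≤ N
      N≤1+i     : N ℕ.≤ suc i
      size      : Size m N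
      spans     : Spans V W
      dominated : Dominated D m W
      untouched : ∀ k → k ℕ.+ i ℕ.< d → D k ≈ 0#
      columns   : ∀ k → k ℕ.< d → d ℕ.≤ k ℕ.+ i → Column W D (λ _ → 1#) k

  column-case : ∀ {k j i} → k ℕ.+ suc i ≡ d → d ℕ.≤ j ℕ.+ suc i → j ≡ k ⊎ (k ℕ.< j × d ℕ.≤ j ℕ.+ i)
  column-case {k} {j} {i} eq d≤ with ℕ.m≤n⇒m<n∨m≡n (ℕ.+-cancelʳ-≤ (suc i) k j (ℕ.≤-trans (ℕ.≤-reflexive eq) d≤))
  ... | inj₂ k≡j = inj₁ (≡.sym k≡j)
  ... | inj₁ k<j = inj₂ (k<j , ℕ.≤-trans (ℕ.≤-reflexive (≡.trans (≡.sym eq) (ℕ.+-suc k i))) (ℕ.+-monoˡ-≤ i k<j))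

  untouched-suc : ∀ {k j i} → k ℕ.+ suc i ≡ d → j ℕ.+ suc i ℕ.< d → j ≢ k × j ℕ.+ i ℕ.< d
  untouched-suc {i = i} eq lt =
    (λ { ≡.refl → ℕ.<-irrefl eq lt }) , ℕ.≤-<-trans (ℕ.+-monoʳ-≤ _ (ℕ.n≤1+n i)) lt

  k<d : ∀ {k i} → k ℕ.+ suc i ≡ d → k ℕ.< d
  k<d {k} eq = ≡.subst (k ℕ.<_) eq (ℕ.m<m+n k (s≤s z≤n))

  skip-column : ∀ {V i W D m} k → k ℕ.+ suc i ≡ d → (∀ v → v ℕ.< n → W v k ≈ 0#) →
                Phase1 V i W D m → Phase1 V (suc i) W D m
  skip-column {i = i} k eq zeroes I = record
    { Phase1 I
    ; N≤1+i     = ℕ.m≤n⇒m≤1+n N≤1+i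
    ; untouched = λ j lt → untouched j (proj₂ (untouched-suc eq lt))
    ; columns   = cols
    }
    where
    open Phase1 I
    cols : _
    cols j j<d d≤ with column-case eq d≤
    ... | inj₂ (_ , d≤′) = columns j j<d d≤′
    ... | inj₁ ≡.refl    = inj₁ (untouched j (≡.subst (λ e → suc e ℕ.≤ d) ≡.refl
            (ℕ.≤-reflexive (≡.trans (≡.sym (ℕ.+-suc j i)) eq))) , refl , zeroes)

  -- Subtracting multiples of W b - δ k instead of W b makes the elimination of
  -- column k and its normalisation one and the same row operation.
  module Pivot {W W′ : Rows} {D D′ : Seq} {m m′ : ℕ → ℕ} (k b : ℕ) (k<d : k ℕ.< d) (b<n : b ℕ.< n)
    (pivot≉0 : ¬ (W b k ≈ 0#))
    (maximal : ∀ v → v ℕ.< n → sq (W v k) ≤ sq (W b k))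
    (row : ∀ v j → v ℕ.< n → j ℕ.< d → W′ v j ≈ W v j - (W b j - δ k j) * (W v k * (W b k) ⁻¹))
    (D′-hit : D′ k ≈ 1#) (D′-miss : ∀ j → j ≢ k → D′ j ≈ D j)
    (inc : Increments b m m′)
    where

    r : Carrier
    r = (W b k) ⁻¹

    p : Seq
    p j = W b j - δ k j

    p-pivot : p k ≈ W b k - 1#
    p-pivot = +-congˡ (-‿cong (reflexive (δ-diagonal k)))

    column : ∀ v → v ℕ.< n → W′ v k ≈ W v k * r
    column v v<n = begin-equality
      W′ v k                                      ≈⟨ row v k v<n k<d ⟩
      W v k - p k * (W v k * r)                   ≈⟨ +-congˡ (-‿cong (*-congʳ p-pivot)) ⟩
      W v k - (W b k - 1#) * (W v k * r)          ≈⟨ solve 3 (λ w b r → w :- (b :- con (1 , 0)) :* (w :* r) := w :* (con (1 , 0) :- b :* r) :+ w :* r) refl (W v k) (W b k) r ⟩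
      W v k * (1# - W b k * r) + W v k * r        ≈⟨ +-congʳ (trans (*-congˡ (trans (+-congˡ (-‿cong (⁻¹-inverseʳ pivot≉0))) (-‿inverseʳ 1#))) (zeroʳ _)) ⟩
      0# + W v k * r                              ≈⟨ +-identityˡ _ ⟩
      W v k * r                                   ∎
      where open ≤-Reasoning

    -- With the new entry `W′ v k` as multiplier, the operation reads `W v = W′ v + W′ v k · p`,
    -- which exhibits its inverse.
    row′ : ∀ v j → v ℕ.< n → j ℕ.< d → W′ v j ≈ W v j - p j * W′ v k
    row′ v j v<n j<d = trans (row v j v<n j<d) (+-congˡ (-‿cong (*-congˡ (sym (column v v<n)))))

    pivot-row : ∀ j → j ℕ.< d → W′ b j ≈ δ k j
    pivot-row j j<d = begin-equality
      W′ b j                       ≈⟨ row′ b j b<n j<d ⟩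
      W b j - p j * W′ b k         ≈⟨ +-congˡ (-‿cong (*-congˡ (trans (column b b<n) (⁻¹-inverseʳ pivot≉0)))) ⟩
      W b j - (W b j - δ k j) * 1# ≈⟨ solve 2 (λ w e → w :- (w :- e) :* con (1 , 0) := e) refl (W b j) (δ k j) ⟩
      δ k j                        ∎
      where open ≤-Reasoning

    dot-row : ∀ g v → v ℕ.< n → dot g (W v) ≈ dot g (W′ v) + dot g p * W′ v k
    dot-row g v v<n = begin-equality
      dot g (W v)                                          ≈⟨ S-cong d (λ j j<d → term j j<d) ⟩
      S d (λ j → g j * W′ v j + W′ v k * (g j * p j))      ≈⟨ S-+ d _ _ ⟩
      dot g (W′ v) + S d (λ j → W′ v k * (g j * p j))      ≈⟨ +-congˡ (trans (S-* d _ _) (*-comm _ _)) ⟩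
      dot g (W′ v) + dot g p * W′ v k                      ∎
      where
      open ≤-Reasoning
      term : ∀ j → j ℕ.< d → g j * W v j ≈ g j * W′ v j + W′ v k * (g j * p j)
      term j j<d = begin-equality
        g j * W v j ≈⟨ solve 4 (λ g w p c → g :* w := g :* (w :- p :* c) :+ c :* (g :* p)) refl (g j) (W v j) (p j) (W′ v k) ⟩
        g j * (W v j - p j * W′ v k) + W′ v k * (g j * p j) ≈⟨ +-congʳ (*-congˡ (row′ v j v<n j<d)) ⟨
        g j * W′ v j + W′ v k * (g j * p j) ∎

    correction : Seq → Carrier
    correction g = - (dot g p * r)

    transform : Transform W W′
    transform = record
      { forth     = λ g → g ⊹ dot g p ∙δ k
      ; forth-dot = λ g v v<n → trans (dot-row g v v<n) (sym (dot-⊹ g (dot g p) k (W′ v) k<d))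
      ; back      = λ g → g ⊹ correction g ∙δ k
      ; back-dot  = back-dot
      }
      where
      open ≤-Reasoning
      back-dot : ∀ g v → v ℕ.< n → dot (g ⊹ correction g ∙δ k) (W v) ≈ dot g (W′ v)
      back-dot g v v<n = begin-equality
        dot (g ⊹ correction g ∙δ k) (W v)             ≈⟨ dot-⊹ g (correction g) k (W v) k<d ⟩
        dot g (W v) + correction g * W v k            ≈⟨ +-congʳ (dot-row g v v<n) ⟩
        dot g (W′ v) + dot g p * W′ v k + correction g * W v k ≈⟨ +-congʳ (+-congˡ (*-congˡ (column v v<n))) ⟩
        dot g (W′ v) + dot g p * (W v k * r) + - (dot g p * r) * W v k
          ≈⟨ solve 4 (λ x c w r → x :+ c :* (w :* r) :+ (:- (c :* r)) :* w := x) refl (dot g (W′ v)) (dot g p) (W v k) r ⟩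
        dot g (W′ v)                                  ∎

    open Transform transform using (forth; forth-dot; back-form) public

    -- The column has been divided by its entry of largest square; squares stand in for absolute
    -- values.
    box-pivot : ∀ v → v ℕ.< n → sq (dot (δ k) (W′ v)) ≤ 1#
    box-pivot v v<n = begin
      sq (dot (δ k) (W′ v))    ≈⟨ sq-cong (trans (δ-dot (W′ v) k k<d) (column v v<n)) ⟩
      sq (W v k * r)           ≈⟨ solve 2 (λ w r → (w :* r) :* (w :* r) := (r :* r) :* (w :* w)) refl (W v k) r ⟩
      sq r * sq (W v k)        ≤⟨ *-monoˡ-≤ (sq-nonNegative r) (maximal v v<n) ⟩
      sq r * sq (W b k)        ≈⟨ solve 2 (λ w r → (r :* r) :* (w :* w) := (w :* r) :* (w :* r)) refl (W b k) r ⟩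
      sq (W b k * r)           ≈⟨ trans (sq-cong (⁻¹-inverseʳ pivot≉0)) (*-identityˡ 1#) ⟩
      1#                       ∎
      where open ≤-Reasoning

    new-column : ∀ {E} → E k ≈ 1# → Column W′ D′ E k
    new-column E≈1 = inj₂ (record
      { weight     = trans D′-hit (sym E≈1)
      ; 1≤weight   = ≤-reflexive (sym E≈1)
      ; functional = δ k
      ; diagonal   = reflexive (δ-diagonal k)
      ; triangular = λ j k<j _ → reflexive (δ-off (ℕ.>⇒≢ k<j))
      ; box        = box-pivot
      })

    old-column : ∀ {E} j → k ℕ.< j → j ℕ.< d → Column W D E j → Column W′ D′ E j
    old-column j k<j j<d (inj₁ (D≈0 , E≈1 , zeroes)) =
      inj₁ (trans (D′-miss j (ℕ.>⇒≢ k<j)) D≈0 , E≈1 , zeroes′)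
      where
      open ≤-Reasoning
      zeroes′ : ∀ v → v ℕ.< n → W′ v j ≈ 0#
      zeroes′ v v<n = begin-equality
        W′ v j                                ≈⟨ row′ v j v<n j<d ⟩
        W v j - (W b j - δ k j) * W′ v k      ≈⟨ +-cong (zeroes v v<n) (-‿cong (*-congʳ (+-cong (zeroes b b<n) (-‿cong (reflexive (δ-off (ℕ.>⇒≢ k<j))))))) ⟩
        0# - (0# - 0#) * W′ v k               ≈⟨ solve 1 (λ x → con (0 , 0) :- (con (0 , 0) :- con (0 , 0)) :* x := con (0 , 0)) refl (W′ v k) ⟩
        0#                                    ∎
    old-column j k<j j<d (inj₂ c) = inj₂ (record
      { weight     = trans (D′-miss j (ℕ.>⇒≢ k<j)) weight
      ; 1≤weight   = 1≤weight
      ; functional = forth functional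
      ; diagonal   = trans (⊹-off functional _ (ℕ.>⇒≢ k<j)) diagonal
      ; triangular = λ i j<i i<d → trans (⊹-off functional _ (ℕ.>⇒≢ (ℕ.<-trans k<j j<i))) (triangular i j<i i<d)
      ; box        = λ v v<n → ≤-respˡ (sq-cong (forth-dot functional v v<n)) (box v v<n)
      })
      where open Active c

    -- The pivot row has become `δ k`, so selecting it adds exactly `sq (g k)` to the form, which
    -- pays for the new weight 1 at `k`. Passing from `g` to `back g` alters only coefficient `k`,
    -- where the old weight is zero.
    dominated : D k ≈ 0# → Dominated D m W → Dominated D′ m′ W′
    dominated D≈0 dom g = begin
      S d (λ j → D′ j * sq (g j))                            ≈⟨ S-update d k k<d hit miss ⟩
      S d (λ j → D j * sq (g j)) + sq (g k)                  ≈⟨ +-congʳ (S-cong d (λ j _ → same j)) ⟩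
      S d (λ j → D j * sq (back g j)) + sq (g k)             ≤⟨ +-monoˡ-≤ _ (dom (back g)) ⟩
      form m W (back g) + sq (g k)                           ≈⟨ +-cong (back-form m g) (sq-cong (sym (trans (dot-congʳ g pivot-row) (dot-δ g k k<d)))) ⟩
      form m W′ g + sq (dot g (W′ b))                        ≈⟨ form-increment b<n inc W′ g ⟨
      form m′ W′ g                                           ∎
      where
      open ≤-Reasoning
      open Transform transform using (back)
      hit : D′ k * sq (g k) ≈ D k * sq (g k) + sq (g k)
      hit = begin-equality
        D′ k * sq (g k)             ≈⟨ trans (*-congʳ D′-hit) (*-identityˡ _) ⟩
        sq (g k)                    ≈⟨ +-identityˡ _ ⟨
        0# + sq (g k)               ≈⟨ +-congʳ (trans (*-congʳ D≈0) (zeroˡ _)) ⟨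
        D k * sq (g k) + sq (g k)   ∎
      miss : ∀ j → j ≢ k → D′ j * sq (g j) ≈ D j * sq (g j)
      miss j j≢k = *-congʳ (D′-miss j j≢k)
      same : ∀ j → D j * sq (g j) ≈ D j * sq (back g j)
      same j with j ℕ.≟ k
      ... | yes ≡.refl = trans (trans (*-congʳ D≈0) (zeroˡ _)) (sym (trans (*-congʳ D≈0) (zeroˡ _)))
      ... | no  _      = *-congˡ (sq-cong (solve 2 (λ g c → g := g :+ c :* con (0 , 0)) refl (g j) _))

    step : ∀ {V i} → k ℕ.+ suc i ≡ d → Phase1 V i W D m → Phase1 V (suc i) W′ D′ m′
    step {V} {i} eq I = record
      { N         = suc N
      ; 1≤N       = s≤s z≤n
      ; N≤1+i     = s≤s N≤1+i
      ; size      = Size-increment {N = N} b<n inc size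
      ; spans     = Transform.spans transform spans
      ; dominated = dominated (untouched k k+i<d) dom
      ; untouched = λ j lt → trans (D′-miss j (proj₁ (untouched-suc eq lt))) (untouched j (proj₂ (untouched-suc eq lt)))
      ; columns   = cols
      }
      where
      open Phase1 I renaming (dominated to dom)
      k+i<d : k ℕ.+ i ℕ.< d
      k+i<d = ℕ.≤-reflexive (≡.trans (≡.sym (ℕ.+-suc k i)) eq)
      cols : ∀ j → j ℕ.< d → d ℕ.≤ j ℕ.+ suc i → Column W′ D′ (λ _ → 1#) j
      cols j j<d d≤ with column-case eq d≤
      ... | inj₂ (k<j , d≤′) = old-column j k<j j<d (columns j j<d d≤′)
      ... | inj₁ ≡.refl      = new-column refl

-- Rank-one updates of a diagonal form, and the selection potential

module RankOneUpdate {a ℓ₁ ℓ₂} (R : Reals a ℓ₁ ℓ₂) (d n : ℕ) where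

  open Coordinates R d n
  open Counting using (bound; d+1<bound; 2^bound>[4bound]^d)

  -- The inverse of D j ≈ 0# is unspecified, but in that case p j ≈ 0#.
  pivotSum : Seq → Seq → Seq
  pivotSum D p zero    = 1#
  pivotSum D p (suc j) = pivotSum D p j + sq (p j) * D j ⁻¹

  -- If D_j ≥ 1, this is p_j / (D_j t_{j+1}) with t the pivot sums, since t_{j+1} D_j = t_j D_j +
  -- p_j². The factor L has the entries L_{ij} = p_i β_j below the diagonal, where β is this
  -- sequence.
  multiplier : Seq → Seq → Seq
  multiplier D p j = p j * (pivotSum D p j * D j + sq (p j)) ⁻¹

  -- If D_j ≥ 1, this is D_j t_{j+1} / t_j. In the form chosen only t_j ≥ 1 is inverted, so the
  -- value is also right, namely zero, where D_j and p_j vanish.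
  newWeight : Seq → Seq → Seq
  newWeight D p j = D j + sq (p j) * (pivotSum D p j) ⁻¹

  -- With z = 0#, newRow solves the triangular system with unit factor L by
  -- substitution, where diag(D) + p pᵀ = L diag(newWeight D p) Lᵀ.
  carry : (p β w : Seq) → Carrier → Seq
  carry p β w z zero    = z
  carry p β w z (suc j) = carry p β w z j + β j * (w j - p j * carry p β w z j)

  newRow : (p β w : Seq) → Carrier → Seq
  newRow p β w z j = w j - p j * carry p β w z j

  carry-zero : ∀ {p β w z} → (∀ j → β j ≈ 0#) → ∀ j → carry p β w z j ≈ z
  carry-zero β≈0 zero    = refl
  carry-zero β≈0 (suc j) = trans (+-cong (carry-zero β≈0 j) (trans (*-congʳ (β≈0 j)) (zeroˡ _))) (+-identityʳ _)

  -- Recursion from `d` down to 0. The induction on `d` shifts `F` and puts one new value in front,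
  -- so the values already found are kept.
  downward : ∀ d (F : ℕ → Carrier → Carrier) →
             Σ[ s ∈ Seq ] (s d ≡ 0# × (∀ k → k ℕ.< d → s k ≡ F k (s (suc k))))
  downward zero    F = (λ _ → 0#) , ≡.refl , λ _ ()
  downward (suc d) F with downward d (F ∘ suc)
  ... | s , end , rec = s′ , end , rec′
    where
    s′ : Seq
    s′ zero    = F 0 (s 0)
    s′ (suc k) = s k
    rec′ : ∀ k → k ℕ.< suc d → s′ k ≡ F k (s′ (suc k))
    rec′ zero    _         = ≡.refl
    rec′ (suc k) (s≤s k<d) = rec k k<d

  -- The axioms do not say that `_⁻¹` respects `_≈_`; inverses of equal elements are identified
  -- through this lemma.
  inverse-unique : ∀ {x y} → 1# ≤ x → x * y ≈ 1# → x ⁻¹ ≈ y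
  inverse-unique {x} {y} 1≤x xy≈1 = begin-equality
    x ⁻¹             ≈⟨ *-identityʳ _ ⟨
    x ⁻¹ * 1#        ≈⟨ *-congˡ xy≈1 ⟨
    x ⁻¹ * (x * y)   ≈⟨ solve 3 (λ i x y → i :* (x :* y) := (x :* i) :* y) refl (x ⁻¹) x y ⟩
    (x * x ⁻¹) * y   ≈⟨ *-congʳ (1≤⇒inverse 1≤x) ⟩
    1# * y           ≈⟨ *-identityˡ y ⟩
    y                ∎
    where open ≤-Reasoning

  module Update (D p E : Seq)
    (support : ∀ j → j ℕ.< d → (D j ≈ 0# × p j ≈ 0#) ⊎ 1# ≤ D j) where

    t β : Seq
    t = pivotSum D p
    β = multiplier D p

    increment-zero : ∀ {j} → p j ≈ 0# → sq (p j) * D j ⁻¹ ≈ 0#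
    increment-zero p≈0 = trans (*-congʳ (trans (*-congʳ p≈0) (zeroˡ _))) (zeroˡ _)

    increment-nonNegative : ∀ j → j ℕ.< d → 0# ≤ sq (p j) * D j ⁻¹
    increment-nonNegative j j<d with support j j<d
    ... | inj₁ (_ , p≈0) = ≤-reflexive (sym (increment-zero p≈0))
    ... | inj₂ 1≤D       = *-nonNegative (sq-nonNegative _) (1≤⇒0≤⁻¹ 1≤D)

    1≤t : ∀ j → j ℕ.≤ d → 1# ≤ t j
    1≤t zero    _   = ≤-refl
    1≤t (suc j) j<d = ≤-trans (1≤t j (ℕ.<⇒≤ j<d)) (x≤x+y (increment-nonNegative j j<d))

    t-total : t d ≈ S d (λ j → sq (p j) * D j ⁻¹) + 1#
    t-total = trans (sym (trans (+-congʳ (S-zero d (λ _ _ → refl))) (+-identityˡ _)))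
      (S-telescope d {f = λ _ → 0#} {z = t} (λ j _ → trans (+-identityˡ _) (+-comm _ _)))

    -- Expand 0 ≤ Σ D (g - c p / D)² with c = p · g.
    covered-dot : t d ≤ 1# + 1# → ∀ g → sq (dot g p) ≤ S d (λ j → D j * sq (g j))
    covered-dot t≤2 g = 0≤y-x⇒x≤y (≤-trans square≥0 (begin
      S d (λ j → D j * sq (g j - c * (p j * D j ⁻¹)))     ≈⟨ S-cong d expand ⟩
      S d (λ j → D j * sq (g j) + (- (c + c) * (g j * p j) + sq c * (sq (p j) * D j ⁻¹)))
        ≈⟨ trans (S-+ d _ _) (+-congˡ (trans (S-+ d _ _) (+-cong (S-* d _ _) (S-* d _ _)))) ⟩
      A + (- (c + c) * c + sq c * B)                      ≤⟨ +-monoʳ-≤ A (+-monoʳ-≤ _ (*-monoˡ-≤ (sq-nonNegative c) B≤1)) ⟩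
      A + (- (c + c) * c + sq c * 1#)                     ≈⟨ solve 2 (λ A c → A :+ ((:- (c :+ c)) :* c :+ c :* c :* con (1 , 0)) := A :- c :* c) refl A c ⟩
      A - sq c                                            ∎))
      where
      open ≤-Reasoning
      c = dot g p
      A = S d (λ j → D j * sq (g j))
      B = S d (λ j → sq (p j) * D j ⁻¹)
      B≤1 : B ≤ 1#
      B≤1 = ≤-respˡ (solve 1 (λ x → (x :+ con (1 , 0)) :- con (1 , 0) := x) refl B)
        (≤-respʳ (solve 0 ((con (1 , 0) :+ con (1 , 0)) :- con (1 , 0) := con (1 , 0)) refl)
          (+-monoˡ-≤ (- 1#) (≤-respˡ t-total t≤2)))
      square≥0 : 0# ≤ S d (λ j → D j * sq (g j - c * (p j * D j ⁻¹)))
      square≥0 = S-nonNegative d (λ j j<d → *-nonNegative (D≥0 j j<d) (sq-nonNegative _))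
        where
        D≥0 : ∀ j → j ℕ.< d → 0# ≤ D j
        D≥0 j j<d with support j j<d
        ... | inj₁ (D≈0 , _) = ≤-reflexive (sym D≈0)
        ... | inj₂ 1≤D       = 1≤⇒0≤ 1≤D
      p-cancel : ∀ j → j ℕ.< d → p j * (D j * D j ⁻¹) ≈ p j
      p-cancel j j<d with support j j<d
      ... | inj₁ (_ , p≈0) = trans (*-congʳ p≈0) (trans (zeroˡ _) (sym p≈0))
      ... | inj₂ 1≤D       = trans (*-congˡ (1≤⇒inverse 1≤D)) (*-identityʳ _)
      expand : ∀ j → j ℕ.< d → D j * sq (g j - c * (p j * D j ⁻¹)) ≈
               D j * sq (g j) + (- (c + c) * (g j * p j) + sq c * (sq (p j) * D j ⁻¹))
      expand j j<d = begin-equality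
        D j * sq (g j - c * (p j * D j ⁻¹))
          ≈⟨ solve 5 (λ D i p g c → D :* ((g :- c :* (p :* i)) :* (g :- c :* (p :* i))) :=
               D :* (g :* g) :+ ((:- (c :+ c)) :* (g :* (p :* (D :* i))) :+ c :* c :* ((p :* (D :* i)) :* p :* i))) refl
               (D j) (D j ⁻¹) (p j) (g j) c ⟩
        D j * sq (g j) + (- (c + c) * (g j * (p j * (D j * D j ⁻¹))) + sq c * ((p j * (D j * D j ⁻¹)) * p j * D j ⁻¹))
          ≈⟨ +-congˡ (+-cong (*-congˡ (*-congˡ (p-cancel j j<d))) (*-congˡ (*-congʳ (*-congʳ (p-cancel j j<d))))) ⟩
        D j * sq (g j) + (- (c + c) * (g j * p j) + sq c * (sq (p j) * D j ⁻¹)) ∎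

    -- g and g′ are the same functional in the old and in the new coordinates,
    -- and s k is the tail Σ_{i ≥ k} pᵢ gᵢ. The relation can be solved for g′ given
    -- g and for g given g′, both times by downward recursion on s.
    record Adjoint (g g′ : Seq) : Set (a ⊔ ℓ₁) where
      field
        s       : Seq
        s-end   : s d ≈ 0#
        s-tail  : ∀ k → k ℕ.< d → s k ≈ s (suc k) + p k * g k
        new     : ∀ k → k ℕ.< d → g′ k ≈ g k + β k * s (suc k)

      s-start : s 0 ≈ dot g p
      s-start = begin-equality
        s 0                     ≈⟨ +-identityˡ _ ⟨
        0# + s 0                ≈⟨ +-congʳ (S-zero d (λ _ _ → refl)) ⟨
        S d (λ _ → 0#) + s 0    ≈⟨ S-telescope d {z = s} (λ k k<d → trans (+-comm _ _) (trans (+-congˡ (*-comm _ _)) (trans (sym (s-tail k k<d)) (sym (+-identityˡ _))))) ⟨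
        dot g p + s d           ≈⟨ trans (+-congˡ s-end) (+-identityʳ _) ⟩
        dot g p                 ∎
        where open ≤-Reasoning

      -- The duality (Lᵀ g) · (L⁻¹ w) = g · w, by summation by parts: carries run upwards, tails run
      -- downwards, and their product is the potential.
      dot-adjoint : ∀ {w w′ z} → (∀ k → k ℕ.< d → w′ k ≈ newRow p β w z k) → z ≈ 0# → dot g w ≈ dot g′ w′
      dot-adjoint {w} {w′} {z} row z≈0 = sym (begin-equality
        dot g′ w′                       ≈⟨ +-identityʳ _ ⟨
        dot g′ w′ + 0#                  ≈⟨ +-congˡ (trans (-‿cong (trans (*-congˡ s-end) (zeroʳ _))) -0≈0) ⟨
        dot g′ w′ - c d * s d           ≈⟨ S-telescope d {z = λ k → - (c k * s k)} step ⟩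
        dot g w - z * s 0               ≈⟨ +-congˡ (trans (-‿cong (trans (*-congʳ z≈0) (zeroˡ _))) -0≈0) ⟩
        dot g w + 0#                    ≈⟨ +-identityʳ _ ⟩
        dot g w                         ∎)
        where
        open ≤-Reasoning
        c = carry p β w z
        -0≈0 : - 0# ≈ 0#
        -0≈0 = solve 0 (:- con (0 , 0) := con (0 , 0)) refl
        step : ∀ k → k ℕ.< d → g′ k * w′ k - c (suc k) * s (suc k) ≈ g k * w k - c k * s k
        step k k<d = begin-equality
          g′ k * w′ k - c (suc k) * s (suc k)
            ≈⟨ +-congʳ (*-cong (new k k<d) (row k k<d)) ⟩
          (g k + β k * s (suc k)) * (w k - p k * c k) - (c k + β k * (w k - p k * c k)) * s (suc k)
            ≈⟨ solve 6 (λ g β s w p c →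
                 (g :+ β :* s) :* (w :- p :* c) :- (c :+ β :* (w :- p :* c)) :* s :=
                 g :* w :- c :* (s :+ p :* g)) refl (g k) (β k) (s (suc k)) (w k) (p k) (c k) ⟩
          g k * w k - c k * (s (suc k) + p k * g k)
            ≈⟨ +-congˡ (-‿cong (*-congˡ (s-tail k k<d))) ⟨
          g k * w k - c k * s k ∎

      -- Completing the square in gₖ.
      square-step : ∀ k → k ℕ.< d →
        newWeight D p k * sq (g′ k) + sq (s (suc k)) * t (suc k) ⁻¹ ≈ D k * sq (g k) + sq (s k) * t k ⁻¹
      square-step k k<d with support k k<d
      ... | inj₁ (D≈0 , p≈0) = begin-equality
        (D k + sq (p k) * t k ⁻¹) * sq (g′ k) + sq (s (suc k)) * t (suc k) ⁻¹
          ≈⟨ +-cong (trans (*-congʳ D′≈0) (zeroˡ _)) (*-cong (sq-cong (sym s≈)) t⁻¹≈) ⟩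
        0# + sq (s k) * t k ⁻¹
          ≈⟨ +-congʳ (trans (*-congʳ D≈0) (zeroˡ _)) ⟨
        D k * sq (g k) + sq (s k) * t k ⁻¹ ∎
        where
        open ≤-Reasoning
        D′≈0 : D k + sq (p k) * t k ⁻¹ ≈ 0#
        D′≈0 = trans (+-cong D≈0 (trans (*-congʳ (trans (*-congʳ p≈0) (zeroˡ _))) (zeroˡ _))) (+-identityʳ _)
        s≈ : s k ≈ s (suc k)
        s≈ = trans (s-tail k k<d) (trans (+-congˡ (trans (*-congʳ p≈0) (zeroˡ _))) (+-identityʳ _))
        t⁻¹≈ : t (suc k) ⁻¹ ≈ t k ⁻¹
        t⁻¹≈ = inverse-unique (1≤t (suc k) k<d)
          (trans (*-congʳ (trans (+-congˡ (increment-zero p≈0)) (+-identityʳ _))) (1≤⇒inverse (1≤t k (ℕ.<⇒≤ k<d))))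
      ... | inj₂ 1≤D = begin-equality
        (D k + sq pk * it) * sq (g′ k) + sq σ * t (suc k) ⁻¹
          ≈⟨ +-cong (*-cong D′≈ (sq-cong (new k k<d))) (*-congˡ it′≈) ⟩
        Δ * it * sq (g k + pk * e * σ) + sq σ * (D k * e)
          ≈⟨ +-congˡ (*-congˡ (trans (*-congˡ (t·it)) (*-identityʳ _))) ⟨
        Δ * it * sq (g k + pk * e * σ) + sq σ * (D k * e * (tk * it))
          ≈⟨ solve 8 (λ D e Δ it tk p g σ →
               Δ :* it :* ((g :+ p :* e :* σ) :* (g :+ p :* e :* σ)) :+ σ :* σ :* (D :* e :* (tk :* it)) :=
               it :* (Δ :* (g :* g) :+ (p :* g :* σ :* (Δ :* e) :+ p :* g :* σ :* (Δ :* e) :+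
                 (p :* p :* σ :* σ :* e :* (Δ :* e) :+ σ :* σ :* e :* (tk :* D)))))
               refl (D k) e Δ it tk pk (g k) σ ⟩
        it * (Δ * sq (g k) + (pk * g k * σ * (Δ * e) + pk * g k * σ * (Δ * e) +
               (pk * pk * σ * σ * e * (Δ * e) + σ * σ * e * (tk * D k))))
          ≈⟨ *-congˡ (+-congˡ (+-cong (+-cong (*-congˡ Δ·e) (*-congˡ Δ·e)) (+-congʳ (*-congˡ Δ·e)))) ⟩
        it * (Δ * sq (g k) + (pk * g k * σ * 1# + pk * g k * σ * 1# +
               (pk * pk * σ * σ * e * 1# + σ * σ * e * (tk * D k))))
          ≈⟨ solve 7 (λ D e it tk p g σ →
               it :* ((tk :* D :+ p :* p) :* (g :* g) :+ (p :* g :* σ :* con (1 , 0) :+ p :* g :* σ :* con (1 , 0) :+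
                 (p :* p :* σ :* σ :* e :* con (1 , 0) :+ σ :* σ :* e :* (tk :* D)))) :=
               D :* (g :* g) :* (tk :* it) :+ (((p :* g) :* (p :* g) :+ p :* g :* σ :+ p :* g :* σ) :* it :+
                 σ :* σ :* it :* ((tk :* D :+ p :* p) :* e)))
               refl (D k) e it tk pk (g k) σ ⟩
        D k * sq (g k) * (tk * it) + ((sq (pk * g k) + pk * g k * σ + pk * g k * σ) * it + σ * σ * it * (Δ * e))
          ≈⟨ +-cong (trans (*-congˡ t·it) (*-identityʳ _)) (+-congˡ (trans (*-congˡ Δ·e) (*-identityʳ _))) ⟩
        D k * sq (g k) + ((sq (pk * g k) + pk * g k * σ + pk * g k * σ) * it + σ * σ * it)
          ≈⟨ solve 5 (λ x it p g σ → x :+ (((p :* g) :* (p :* g) :+ p :* g :* σ :+ p :* g :* σ) :* it :+ σ :* σ :* it) :=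
               x :+ (σ :+ p :* g) :* (σ :+ p :* g) :* it) refl (D k * sq (g k)) it pk (g k) σ ⟩
        D k * sq (g k) + sq (σ + pk * g k) * it
          ≈⟨ +-congˡ (*-congʳ (sq-cong (s-tail k k<d))) ⟨
        D k * sq (g k) + sq (s k) * it ∎
        where
        open ≤-Reasoning
        pk = p k
        tk = t k
        it = t k ⁻¹
        σ  = s (suc k)
        Δ  = t k * D k + sq (p k)
        e  = Δ ⁻¹
        t·it : tk * it ≈ 1#
        t·it = 1≤⇒inverse (1≤t k (ℕ.<⇒≤ k<d))
        1≤Δ : 1# ≤ Δ
        1≤Δ = ≤-trans (≤-respˡ (*-identityˡ 1#) (*-mono-≤ 0≤1 (1≤⇒0≤ (1≤t k (ℕ.<⇒≤ k<d))) (1≤t k (ℕ.<⇒≤ k<d)) 1≤D))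
          (x≤x+y (sq-nonNegative pk))
        Δ·e : Δ * e ≈ 1#
        Δ·e = 1≤⇒inverse 1≤Δ
        D′≈ : D k + sq pk * it ≈ Δ * it
        D′≈ = trans (+-congʳ (sym (trans (*-congˡ t·it) (*-identityʳ _))))
          (solve 4 (λ D t i p → D :* (t :* i) :+ p :* p :* i := (t :* D :+ p :* p) :* i) refl (D k) tk it pk)
        it′≈ : t (suc k) ⁻¹ ≈ D k * e
        it′≈ = inverse-unique (1≤t (suc k) k<d) (begin-equality
          (tk + sq pk * D k ⁻¹) * (D k * e)
            ≈⟨ solve 5 (λ t p i D e → (t :+ p :* p :* i) :* (D :* e) := (t :* D :+ p :* p :* (D :* i)) :* e) refl tk pk (D k ⁻¹) (D k) e ⟩
          (tk * D k + sq pk * (D k * D k ⁻¹)) * e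
            ≈⟨ *-congʳ (+-congˡ (trans (*-congˡ (1≤⇒inverse 1≤D)) (*-identityʳ _))) ⟩
          Δ * e ≈⟨ Δ·e ⟩
          1# ∎)

      -- The identity gᵀ (diag(D) + p pᵀ) g = g′ᵀ diag(D′) g′ with g′ = Lᵀ g and D′ the new weights.
      -- In the telescoped sum of `square-step` the boundary terms are (s d)² / t d = 0 and (s 0)² /
      -- t 0 = (g · p)².
      quadratic : S d (λ k → newWeight D p k * sq (g′ k)) ≈ S d (λ k → D k * sq (g k)) + sq (dot g p)
      quadratic = begin-equality
        S d (λ k → newWeight D p k * sq (g′ k))                          ≈⟨ +-identityʳ _ ⟨
        S d (λ k → newWeight D p k * sq (g′ k)) + 0#                     ≈⟨ +-congˡ (trans (*-congʳ (trans (*-congʳ s-end) (zeroˡ _))) (zeroˡ _)) ⟨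
        S d (λ k → newWeight D p k * sq (g′ k)) + sq (s d) * t d ⁻¹      ≈⟨ S-telescope d {z = λ k → sq (s k) * t k ⁻¹} square-step ⟩
        S d (λ k → D k * sq (g k)) + sq (s 0) * 1# ⁻¹                    ≈⟨ +-congˡ (trans (*-congˡ (inverse-unique ≤-refl (*-identityʳ 1#))) (trans (*-identityʳ _) (sq-cong s-start))) ⟩
        S d (λ k → D k * sq (g k)) + sq (dot g p)                        ∎
        where open ≤-Reasoning

      tail-zero : ∀ j → (∀ k → j ℕ.< k → k ℕ.< d → g k ≈ 0#) → ∀ e k → k ℕ.+ e ≡ d → j ℕ.< k → s k ≈ 0#
      tail-zero j zeroes zero    k eq j<k = trans (reflexive (≡.cong s (≡.trans (≡.sym (ℕ.+-identityʳ k)) eq))) s-end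
      tail-zero j zeroes (suc e) k eq j<k = begin-equality
        s k                      ≈⟨ s-tail k k<d ⟩
        s (suc k) + p k * g k    ≈⟨ +-cong (tail-zero j zeroes e (suc k) (≡.trans (≡.sym (ℕ.+-suc k e)) eq) (ℕ.m≤n⇒m≤1+n j<k))
                                     (trans (*-congˡ (zeroes k j<k k<d)) (zeroʳ _)) ⟩
        0# + 0#                  ≈⟨ +-identityʳ _ ⟩
        0#                       ∎
        where
        open ≤-Reasoning
        k<d : k ℕ.< d
        k<d = ≡.subst (k ℕ.<_) eq (ℕ.m<m+n k (s≤s z≤n))

      -- The tail after index k involves only coefficients of `g` behind j, all zero. Hence unit
      -- diagonal and triangular shape survive the update.
      new-tail : ∀ j k → (∀ k → j ℕ.< k → k ℕ.< d → g k ≈ 0#) → j ℕ.≤ k → k ℕ.< d → g′ k ≈ g k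
      new-tail j k zeroes j≤k k<d = trans (new k k<d) (trans
        (+-congˡ (trans (*-congˡ (tail-zero j zeroes (d ℕ.∸ suc k) (suc k) (ℕ.m+[n∸m]≡n k<d) (s≤s j≤k))) (zeroʳ _)))
        (+-identityʳ _))

    forth : ∀ g → Σ[ g′ ∈ Seq ] Adjoint g g′
    forth g with downward d (λ k y → y + p k * g k)
    ... | s , end , rec = (λ k → g k + β k * s (suc k)) , record
      { s = s ; s-end = reflexive end ; s-tail = λ k k<d → reflexive (rec k k<d) ; new = λ _ _ → refl }

    back : ∀ g′ → Σ[ g ∈ Seq ] Adjoint g g′
    back g′ with downward d (λ k y → y + p k * (g′ k - β k * y))
    ... | s , end , rec = (λ k → g′ k - β k * s (suc k)) , record
      { s = s ; s-end = reflexive end ; s-tail = λ k k<d → reflexive (rec k k<d)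
      ; new = λ k _ → solve 2 (λ g x → g := g :- x :+ x) refl (g′ k) _ }

    E′ : Seq
    E′ j = E j * t (suc j) * t j ⁻¹

    E′-ratio : ∀ j → j ℕ.< d → E′ j * t j ≈ E j * t (suc j)
    E′-ratio j j<d = begin-equality
      E j * t (suc j) * t j ⁻¹ * t j   ≈⟨ solve 3 (λ x i t → x :* i :* t := x :* (t :* i)) refl _ (t j ⁻¹) (t j) ⟩
      E j * t (suc j) * (t j * t j ⁻¹) ≈⟨ trans (*-congˡ (1≤⇒inverse (1≤t j (ℕ.<⇒≤ j<d)))) (*-identityʳ _) ⟩
      E j * t (suc j)                  ∎
      where open ≤-Reasoning

    -- The matrix determinant lemma, det (D + p pᵀ) = det D · (1 + pᵀ D⁻¹ p): the factors t_{j+1} /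
    -- t_j telescope, starting from t_0 = 1.
    Π-ratio : Π d E′ ≈ Π d E * t d
    Π-ratio = trans (sym (*-identityʳ _)) (Π-telescope d {z = t} E′-ratio)

  -- In `potential` the factor `2 ^ suc d` pays for the at most d + 1 selections made before this
  -- phase. Every later selection at least doubles the product of `E`.
  record Phase2 (V : Rows) (u : ℕ) (W : Rows) (D : Seq) (m : ℕ → ℕ) : Set (a ⊔ ℓ₁ ⊔ ℓ₂) where
    field
      N         : ℕ
      E         : Seq
      1≤N       : 1 ℕ.≤ N
      N<bound   : N ℕ.< bound d
      size      : Size m N
      spans     : Spans V W
      dominated : Dominated D m W
      columns   : ∀ j → j ℕ.< d → Column W D E j
      potential : fromℕ (2 ℕ.^ N) ≤ fromℕ (2 ℕ.^ suc d) * Π d E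
      covered   : ∀ v → v ℕ.< u → v ℕ.< n → Covered m W v

  -- Since N grows by one at a time from below the bound, it is enough to rule out equality; no
  -- monotonicity of 2^N against (4 N)^d is needed.
  size≢bound : ∀ {E N} → 1 ℕ.≤ d → (∀ j → j ℕ.< d → 0# ≤ E j × E j ≤ fromℕ N) →
               fromℕ (2 ℕ.^ N) ≤ fromℕ (2 ℕ.^ suc d) * Π d E → N ≢ bound d
  size≢bound {E} {N} 1≤d E≤N potential eq = 2^bound>[4bound]^d d 1≤d (≡.subst (λ N → 2 ℕ.^ N ℕ.≤ (4 ℕ.* N) ℕ.^ d) eq
    (fromℕ-reflects-≤ (2 ℕ.^ N) _ (begin
      fromℕ (2 ℕ.^ N)                                ≤⟨ potential ⟩
      fromℕ (2 ℕ.^ suc d) * Π d E                    ≤⟨ *-monoˡ-≤ (fromℕ-nonNegative (2 ℕ.^ suc d)) (proj₂ (Π-bound d N E≤N)) ⟩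
      fromℕ (2 ℕ.^ suc d) * fromℕ (N ℕ.^ d)          ≈⟨ fromℕ-* (2 ℕ.^ suc d) (N ℕ.^ d) ⟨
      fromℕ (2 ℕ.^ suc d ℕ.* N ℕ.^ d)                ≤⟨ fromℕ-mono (ℕ.*-monoˡ-≤ (N ℕ.^ d) 2^[1+d]≤4^d) ⟩
      fromℕ (4 ℕ.^ d ℕ.* N ℕ.^ d)                    ≡⟨ ≡.cong fromℕ (≡.sym (^-distribʳ d)) ⟩
      fromℕ ((4 ℕ.* N) ℕ.^ d)                        ∎)))
    where
    open ≤-Reasoning
    2^[1+d]≤4^d : 2 ℕ.^ suc d ℕ.≤ 4 ℕ.^ d
    2^[1+d]≤4^d = ℕ.≤-trans (ℕ.^-monoʳ-≤ 2 (ℕ.≤-trans (ℕ.+-monoˡ-≤ d 1≤d) (ℕ.+-monoʳ-≤ d (ℕ.≤-reflexive (≡.sym (ℕ.+-identityʳ d))))))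
      (ℕ.≤-reflexive (≡.sym (ℕ.^-*-assoc 2 2 d)))
    ^-distribʳ : ∀ k → (4 ℕ.* N) ℕ.^ k ≡ 4 ℕ.^ k ℕ.* N ℕ.^ k
    ^-distribʳ zero    = ≡.refl
    ^-distribʳ (suc k) = ≡.trans (≡.cong (4 ℕ.* N ℕ.*_) (^-distribʳ k))
      (+-*-Solver.solve 3 (λ x y z → con′ 4 :*′ x :*′ (y :*′ z) :=′ con′ 4 :*′ y :*′ (x :*′ z)) ≡.refl N (4 ℕ.^ k) (N ℕ.^ k))
      where open +-*-Solver using () renaming (con to con′; _:*_ to _:*′_; _:=_ to _:=′_)

  Π-one : ∀ k → Π k (λ _ → 1#) ≈ 1#
  Π-one zero    = refl
  Π-one (suc k) = trans (*-identityˡ _) (Π-one k)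

  open Elimination R d n using (Phase1)

  start : ∀ {V W D m} → 1 ℕ.≤ d → Phase1 V d W D m → Phase2 V 0 W D m
  start 1≤d I = record
    { N         = N
    ; E         = λ _ → 1#
    ; 1≤N       = 1≤N
    ; N<bound   = ℕ.≤-<-trans N≤1+i (d+1<bound d 1≤d)
    ; size      = size
    ; spans     = spans
    ; dominated = dominated
    ; columns   = λ j j<d → columns j j<d (ℕ.m≤n+m d j)
    ; potential = ≤-trans (fromℕ-mono (ℕ.^-monoʳ-≤ 2 N≤1+i)) (≤-reflexive (sym (trans (*-congˡ (Π-one d)) (*-identityʳ _))))
    ; covered   = λ _ ()
    }
    where open Phase1 I

  ≤-suc-split : ∀ {v u} → v ℕ.< suc u → v ℕ.< u ⊎ v ≡ u
  ≤-suc-split (s≤s v≤u) = ℕ.m≤n⇒m<n∨m≡n v≤u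

  module Row {W : Rows} {D E : Seq} (u : ℕ) (u<n : u ℕ.< n) (columns : ∀ j → j ℕ.< d → Column W D E j) where

    support : ∀ j → j ℕ.< d → (D j ≈ 0# × W u j ≈ 0#) ⊎ 1# ≤ D j
    support j j<d with columns j j<d
    ... | inj₁ (D≈0 , _ , zeroes) = inj₁ (D≈0 , zeroes u u<n)
    ... | inj₂ c                  = inj₂ (≤-respʳ (sym (Active.weight c)) (Active.1≤weight c))

    open Update D (W u) E support public

  skip-row : ∀ {V W D m u} → u ℕ.< n → pivotSum D (W u) d ≤ 1# + 1# → Phase2 V u W D m → Phase2 V (suc u) W D m
  skip-row {m = m} {u} u<n t≤2 I = record { Phase2 I ; covered = cov }
    where
    open Phase2 I
    cov : ∀ v → v ℕ.< suc u → v ℕ.< n → Covered m _ v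
    cov v v<1+u v<n g with ≤-suc-split v<1+u
    ... | inj₁ v<u    = covered v v<u v<n g
    ... | inj₂ ≡.refl = ≤-trans (Row.covered-dot u u<n columns t≤2 g) (dominated g)

  -- The `z` in `row` is the initial carry as the program computes it, an entry times `0#`. It
  -- vanishes only up to `_≈_` and depends on the row.
  module Insert {V W W′ : Rows} {D D′ : Seq} {m m′ : ℕ → ℕ} (u : ℕ) (1≤d : 1 ℕ.≤ d) (u<n : u ℕ.< n)
    (t≰2 : ¬ (pivotSum D (W u) d ≤ 1# + 1#))
    (row : ∀ v → v ℕ.< n → Σ[ z ∈ Carrier ]
             (z ≈ 0# × (∀ j → j ℕ.< d → W′ v j ≈ newRow (W u) (multiplier D (W u)) (W v) z j)))
    (weight′ : ∀ j → j ℕ.< d → D′ j ≈ newWeight D (W u) j)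
    (inc : Increments u m m′)
    (I : Phase2 V u W D m)
    where

    open Phase2 I
    open Row u u<n columns

    p : Seq
    p = W u

    dots : ∀ {g g′} → Adjoint g g′ → ∀ v → v ℕ.< n → dot g (W v) ≈ dot g′ (W′ v)
    dots A v v<n = Adjoint.dot-adjoint A (proj₂ (proj₂ (row v v<n))) (proj₁ (proj₂ (row v v<n)))

    transform : Transform W W′
    transform = record
      { forth     = λ g → proj₁ (forth g)
      ; forth-dot = λ g → dots (proj₂ (forth g))
      ; back      = λ g → proj₁ (back g)
      ; back-dot  = λ g → dots (proj₂ (back g))
      }

    dominated′ : Dominated D′ m′ W′
    dominated′ g′ = begin
      S d (λ j → D′ j * sq (g′ j))                       ≈⟨ S-cong d (λ j j<d → *-congʳ (weight′ j j<d)) ⟩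
      S d (λ j → newWeight D p j * sq (g′ j))            ≈⟨ Adjoint.quadratic A ⟩
      S d (λ j → D j * sq (g j)) + sq (dot g p)          ≤⟨ +-monoˡ-≤ _ (dominated g) ⟩
      form m W g + sq (dot g p)                          ≈⟨ +-cong (Transform.back-form transform m g′) (sq-cong (dots A u u<n)) ⟩
      form m W′ g′ + sq (dot g′ (W′ u))                  ≈⟨ form-increment u<n inc W′ g′ ⟨
      form m′ W′ g′                                      ∎
      where
      open ≤-Reasoning
      g = proj₁ (back g′)
      A = proj₂ (back g′)

    columns′ : ∀ j → j ℕ.< d → Column W′ D′ E′ j
    columns′ j j<d with columns j j<d
    ... | inj₁ (D≈0 , E≈1 , zeroes) = inj₁
      ( trans (weight′ j j<d) (trans (+-cong D≈0 (trans (*-congʳ (trans (*-congʳ p≈0) (zeroˡ _))) (zeroˡ _))) (+-identityʳ _))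
      , trans (*-congʳ (trans (*-cong E≈1 (trans (+-congˡ (increment-zero p≈0)) (+-identityʳ _))) (*-identityˡ _)))
          (1≤⇒inverse (1≤t j (ℕ.<⇒≤ j<d)))
      , λ v v<n → trans (proj₂ (proj₂ (row v v<n)) j j<d)
          (trans (+-cong (zeroes v v<n) (-‿cong (trans (*-congʳ p≈0) (zeroˡ _)))) (-‿inverseʳ 0#)) )
      where
      p≈0 : p j ≈ 0#
      p≈0 = zeroes u u<n
    ... | inj₂ c = inj₂ (record
      { weight     = trans (weight′ j j<d) D′≈E′
      ; 1≤weight   = ≤-respʳ D′≈E′ (≤-trans 1≤D (x≤x+y (*-nonNegative (sq-nonNegative _) (1≤⇒0≤⁻¹ 1≤tj))))
      ; functional = g′
      ; diagonal   = trans (Adjoint.new-tail A j j triangular ℕ.≤-refl j<d) diagonal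
      ; triangular = λ k j<k k<d → trans (Adjoint.new-tail A j k triangular (ℕ.<⇒≤ j<k) k<d) (triangular k j<k k<d)
      ; box        = λ v v<n → ≤-respˡ (sq-cong (dots A v v<n)) (box v v<n)
      })
      where
      open ≤-Reasoning
      open Active c
      g′ = proj₁ (forth functional)
      A = proj₂ (forth functional)
      1≤tj : 1# ≤ t j
      1≤tj = 1≤t j (ℕ.<⇒≤ j<d)
      1≤D : 1# ≤ D j
      1≤D = ≤-respʳ (sym weight) 1≤weight
      D′≈E′ : newWeight D p j ≈ E′ j
      D′≈E′ = begin-equality
        D j + sq (p j) * t j ⁻¹
          ≈⟨ +-cong (trans (*-congˡ (1≤⇒inverse 1≤tj)) (*-identityʳ _)) (trans (*-congˡ (1≤⇒inverse 1≤D)) (*-identityʳ _)) ⟨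
        D j * (t j * t j ⁻¹) + sq (p j) * t j ⁻¹ * (D j * D j ⁻¹)
          ≈⟨ solve 5 (λ D t it p i → D :* (t :* it) :+ p :* p :* it :* (D :* i) := D :* (t :+ p :* p :* i) :* it) refl
               (D j) (t j) (t j ⁻¹) (p j) (D j ⁻¹) ⟩
        D j * t (suc j) * t j ⁻¹
          ≈⟨ *-congʳ (*-congʳ weight) ⟩
        E′ j ∎

    potential′ : fromℕ (2 ℕ.^ suc N) ≤ fromℕ (2 ℕ.^ suc d) * Π d E′
    potential′ = begin
      fromℕ (2 ℕ.* 2 ℕ.^ N)                        ≈⟨ fromℕ-* 2 (2 ℕ.^ N) ⟩
      fromℕ 2 * fromℕ (2 ℕ.^ N)                    ≤⟨ *-mono-≤ (fromℕ-nonNegative (2 ℕ.^ N)) 0≤t 2≤t potential ⟩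
      t d * (fromℕ (2 ℕ.^ suc d) * Π d E)          ≈⟨ solve 3 (λ t c x → t :* (c :* x) := c :* (x :* t)) refl (t d) _ _ ⟩
      fromℕ (2 ℕ.^ suc d) * (Π d E * t d)          ≈⟨ *-congˡ Π-ratio ⟨
      fromℕ (2 ℕ.^ suc d) * Π d E′                 ∎
      where
      open ≤-Reasoning
      2≤t : fromℕ 2 ≤ t d
      2≤t = ≤-respˡ (+-congˡ (sym fromℕ-1)) (≰⇒≥ t≰2)
      0≤t : 0# ≤ t d
      0≤t = ≤-trans (fromℕ-nonNegative 2) 2≤t

    size′ : Size m′ (suc N)
    size′ = Size-increment {N = N} u<n inc size

    step : Phase2 V (suc u) W′ D′ m′
    step = record
      { N         = suc N
      ; E         = E′
      ; 1≤N       = s≤s z≤n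
      ; N<bound   = ℕ.≤∧≢⇒< N<bound (size≢bound 1≤d
                      (column-bound {m = m′} {N = suc N} columns′ dominated′ size′ (s≤s z≤n)) potential′)
      ; size      = size′
      ; spans     = Transform.spans transform spans
      ; dominated = dominated′
      ; columns   = columns′
      ; potential = potential′
      ; covered   = cov
      }
      where
      cov : ∀ v → v ℕ.< suc u → v ℕ.< n → Covered m′ W′ v
      cov v v<1+u v<n g with ≤-suc-split v<1+u
      ... | inj₁ v<u    = ≤-trans (Transform.covered transform {m = m} v<n (covered v v<u v<n) g) (form-increment-≤ u<n inc W′ g)
      ... | inj₂ ≡.refl = ≤-respʳ (sym (form-increment u<n inc W′ g)) (≤-respʳ (+-comm _ _)
            (x≤x+y (S-nonNegative n (λ v _ → *-nonNegative (fromℕ-nonNegative (m v)) (sq-nonNegative _)))))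

-- Syntactic footprint and cost of programs

writesNat : Name → Program → Bool
writesNat y skip              = false
writesNat y (setNat x e f)    = x ≡ᵇ y
writesNat y (setReal x e f p) = false
writesNat y (P ﹔ Q)          = writesNat y P ∨ writesNat y Q
writesNat y (ifte b P Q)      = writesNat y P ∨ writesNat y Q
writesNat y (while b P)       = writesNat y P

writesReal : Name → Program → Bool
writesReal y skip              = false
writesReal y (setNat x e f)    = false
writesReal y (setReal x e f p) = x ≡ᵇ y
writesReal y (P ﹔ Q)          = writesReal y P ∨ writesReal y Q
writesReal y (ifte b P Q)      = writesReal y P ∨ writesReal y Q
writesReal y (while b P)       = writesReal y P

scalar : Name → NatExp
scalar x = cell x (lit 0)

-- With `lit 1` on the left, the new value reduces to `suc` of the old one.
increment : Name → Program
increment x = setNat x (lit 0) (lit 1 ⊕ scalar x)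

for : Name → Name → Program → Program
for x y P = setNat x (lit 0) (lit 0) ﹔ while (lit 1 ⊕ scalar x ≤ⁿ scalar y) (P ﹔ increment x)

-- The exponent of a running time bound for programs all of whose loops are
-- for loops.
cost : Program → ℕ
cost skip              = 0
cost (setNat x e f)    = 0
cost (setReal x e f p) = 0
cost (P ﹔ Q)          = suc (cost P ℕ.+ cost Q)
cost (ifte b P Q)      = suc (cost P ℕ.+ cost Q)
cost (while b P)       = 3 ℕ.+ cost P

≡ᵇ-refl : ∀ x → (x ≡ᵇ x) ≡ true
≡ᵇ-refl zero    = ≡.refl
≡ᵇ-refl (suc x) = ≡ᵇ-refl x

≢⇒≡ᵇ-false : ∀ {x y} → x ≢ y → (x ≡ᵇ y) ≡ false
≢⇒≡ᵇ-false {x} {y} x≢y with x ≡ᵇ y in eq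
... | false = ≡.refl
... | true  = ⊥-elim (x≢y (ℕ.≡ᵇ⇒≡ x y (≡.subst T (≡.sym eq) _)))

∨-false : ∀ {b c} → b ∨ c ≡ false → b ≡ false × c ≡ false
∨-false {false} eq = ≡.refl , eq
∨-false {true} ()

T⇒≡true : ∀ {b} → T b → b ≡ true
T⇒≡true {true} _ = ≡.refl

<⇒test : ∀ {i m} → i ℕ.< m → (suc i ℕ.≤ᵇ m) ≡ true
<⇒test i<m = T⇒≡true (ℕ.≤⇒≤ᵇ i<m)

≮⇒test : ∀ {m} → (suc m ℕ.≤ᵇ m) ≡ false
≮⇒test {m} with suc m ℕ.≤ᵇ m in eq
... | false = ≡.refl
... | true  = ⊥-elim (ℕ.<-irrefl ≡.refl (ℕ.≤ᵇ⇒≤ (suc m) m (≡.subst T (≡.sym eq) _)))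

-- A program logic with frames and time bounds

module Execution {a ℓ₁ ℓ₂} (R : Reals a ℓ₁ ℓ₂) (H : ℕ) (2≤H : 2 ℕ.≤ H) where

  open Spanners R public hiding (fromℕ)
  open State public
  open Reals R using (Carrier)

  record Frame (P : Program) (s s′ : State) : Set a where
    field
      nat  : ∀ y → writesNat y P ≡ false → nats s′ y ≡ nats s y
      real : ∀ y → writesReal y P ≡ false → reals s′ y ≡ reals s y

    natCell : ∀ y → writesNat y P ≡ false → ∀ i → nats s′ y i ≡ nats s y i
    natCell y h i = ≡.cong (λ f → f i) (nat y h)

  nats-write-miss : ∀ x i m s {y} → (x ≡ᵇ y) ≡ false → nats (writeNat x i m s) y ≡ nats s y
  nats-write-miss x i m s h rewrite h = ≡.refl

  reals-write-miss : ∀ x i j r s {y} → (x ≡ᵇ y) ≡ false → reals (writeReal x i j r s) y ≡ reals s y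
  reals-write-miss x i j r s h rewrite h = ≡.refl

  -- The arrays agree as functions, because a write to another name reduces to the old array.
  -- Invariants that take whole arrays can thus be carried along by rewriting.
  nats-frame : ∀ {P s s′ t} → ⟨ P , s ⟩⇓⟨ s′ , t ⟩ → ∀ y → writesNat y P ≡ false → nats s′ y ≡ nats s y
  nats-frame ⇓skip y h = ≡.refl
  nats-frame {s = s} (⇓setNat {x = x} {e} {f}) y h = nats-write-miss x (⟦ e ⟧ⁿ s) (⟦ f ⟧ⁿ s) s h
  nats-frame ⇓setReal y h = ≡.refl
  nats-frame (⇓seq D E) y h = ≡.trans (nats-frame E y (proj₂ (∨-false h))) (nats-frame D y (proj₁ (∨-false h)))
  nats-frame (⇓if-true _ D) y h = nats-frame D y (proj₁ (∨-false h))
  nats-frame {ifte b P Q} (⇓if-false _ D) y h = nats-frame D y (proj₂ (∨-false {writesNat y P} h))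
  nats-frame (⇓while-true _ D E) y h = ≡.trans (nats-frame E y h) (nats-frame D y h)
  nats-frame (⇓while-false _) y h = ≡.refl

  reals-frame : ∀ {P s s′ t} → ⟨ P , s ⟩⇓⟨ s′ , t ⟩ → ∀ y → writesReal y P ≡ false → reals s′ y ≡ reals s y
  reals-frame ⇓skip y h = ≡.refl
  reals-frame ⇓setNat y h = ≡.refl
  reals-frame {s = s} (⇓setReal {x = x} {e} {f} {p}) y h = reals-write-miss x (⟦ e ⟧ⁿ s) (⟦ f ⟧ⁿ s) (⟦ p ⟧ʳ s) s h
  reals-frame (⇓seq D E) y h = ≡.trans (reals-frame E y (proj₂ (∨-false h))) (reals-frame D y (proj₁ (∨-false h)))
  reals-frame (⇓if-true _ D) y h = reals-frame D y (proj₁ (∨-false h))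
  reals-frame {ifte b P Q} (⇓if-false _ D) y h = reals-frame D y (proj₂ (∨-false {writesReal y P} h))
  reals-frame (⇓while-true _ D E) y h = ≡.trans (reals-frame E y h) (reals-frame D y h)
  reals-frame (⇓while-false _) y h = ≡.refl

  frame : ∀ {P s s′ t} → ⟨ P , s ⟩⇓⟨ s′ , t ⟩ → Frame P s s′
  frame D = record { nat = nats-frame D ; real = reals-frame D }

  -- Total correctness from a given start state. The exponent of the time bound depends on the
  -- program text alone, so the bounds compose without any knowledge of the states.
  record Run {ℓ} (P : Program) (s : State) (Q : State → Set ℓ) : Set (a ⊔ ℓ) where
    constructor run
    field
      {final}    : State
      {time}     : ℕ
      evaluation : ⟨ P , s ⟩⇓⟨ final , time ⟩
      bounded    : time ℕ.≤ H ℕ.^ cost P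
      post       : Q final

  H^≥1 : ∀ c → 1 ℕ.≤ H ℕ.^ c
  H^≥1 c = ℕ.≤-trans (ℕ.≤-reflexive (≡.sym (ℕ.^-zeroˡ c))) (ℕ.^-monoˡ-≤ c (ℕ.≤-trans (s≤s z≤n) 2≤H))

  H^-mono : ∀ {c e} → c ℕ.≤ e → H ℕ.^ c ℕ.≤ H ℕ.^ e
  H^-mono = ℕ.^-monoʳ-≤ H {{ℕ.>-nonZero (ℕ.≤-trans (s≤s z≤n) 2≤H)}}

  double : ∀ {t u} c → t ℕ.≤ H ℕ.^ c → u ℕ.≤ H ℕ.^ c → t ℕ.+ u ℕ.≤ H ℕ.^ suc c
  double {t} {u} c h k = begin
    t ℕ.+ u                   ≤⟨ ℕ.+-mono-≤ h k ⟩
    H ℕ.^ c ℕ.+ H ℕ.^ c       ≡⟨ ≡.cong (H ℕ.^ c ℕ.+_) (≡.sym (ℕ.+-identityʳ _)) ⟩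
    2 ℕ.* H ℕ.^ c             ≤⟨ ℕ.*-monoˡ-≤ (H ℕ.^ c) 2≤H ⟩
    H ℕ.* H ℕ.^ c             ∎
    where open ℕ.≤-Reasoning

  run-setNat : ∀ {ℓ x e f s} {Q : State → Set ℓ} → Q (writeNat x (⟦ e ⟧ⁿ s) (⟦ f ⟧ⁿ s) s) → Run (setNat x e f) s Q
  run-setNat = run ⇓setNat (s≤s z≤n)

  run-setReal : ∀ {ℓ x e f p s} {Q : State → Set ℓ} →
                Q (writeReal x (⟦ e ⟧ⁿ s) (⟦ f ⟧ⁿ s) (⟦ p ⟧ʳ s) s) → Run (setReal x e f p) s Q
  run-setReal = run ⇓setReal (s≤s z≤n)

  run-skip : ∀ {ℓ s} {Q : State → Set ℓ} → Q s → Run skip s Q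
  run-skip = run ⇓skip (s≤s z≤n)

  run-seq : ∀ {ℓ ℓ′ P P′ s} {Q : State → Set ℓ} {Q′ : State → Set ℓ′} → Run P s Q →
            (∀ s′ → Frame P s s′ → Q s′ → Run P′ s′ Q′) → Run (P ﹔ P′) s Q′
  run-seq {P = P} {P′} (run D t≤ q) k with k _ (frame D) q
  ... | run E u≤ q′ = run (⇓seq D E)
    (double (cost P ℕ.+ cost P′) (ℕ.≤-trans t≤ (H^-mono (ℕ.m≤m+n (cost P) (cost P′))))
                                 (ℕ.≤-trans u≤ (H^-mono (ℕ.m≤n+m (cost P′) (cost P))))) q′

  nat≔_ : ∀ {ℓ x e f P s} {Q : State → Set ℓ} → Run P (writeNat x (⟦ e ⟧ⁿ s) (⟦ f ⟧ⁿ s) s) Q → Run (setNat x e f ﹔ P) s Q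
  nat≔_ {P = P} (run E u≤ q) = run (⇓seq ⇓setNat E) (double (cost P) (H^≥1 (cost P)) u≤) q

  real≔_ : ∀ {ℓ x e f p P s} {Q : State → Set ℓ} →
           Run P (writeReal x (⟦ e ⟧ⁿ s) (⟦ f ⟧ⁿ s) (⟦ p ⟧ʳ s) s) Q → Run (setReal x e f p ﹔ P) s Q
  real≔_ {P = P} (run E u≤ q) = run (⇓seq ⇓setReal E) (double (cost P) (H^≥1 (cost P)) u≤) q

  run-if : ∀ {ℓ b P P′ s} {Q : State → Set ℓ} → (⟦ b ⟧ᵗ s ≡ true → Run P s Q) →
           (⟦ b ⟧ᵗ s ≡ false → Run P′ s Q) → Run (ifte b P P′) s Q
  run-if {b = b} {P} {P′} {s} yes-case no-case with ⟦ b ⟧ᵗ s in eq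
  ... | true  with yes-case ≡.refl
  ...   | run D t≤ q = run (⇓if-true eq D)
           (double (cost P ℕ.+ cost P′) (H^≥1 (cost P ℕ.+ cost P′)) (ℕ.≤-trans t≤ (H^-mono (ℕ.m≤m+n (cost P) (cost P′))))) q
  run-if {b = b} {P} {P′} {s} yes-case no-case | false with no-case ≡.refl
  ...   | run D t≤ q = run (⇓if-false eq D)
           (double (cost P ℕ.+ cost P′) (H^≥1 (cost P ℕ.+ cost P′)) (ℕ.≤-trans t≤ (H^-mono (ℕ.m≤n+m (cost P′) (cost P))))) q

  Frame-trans : ∀ {P s s′ s″} → Frame P s s′ → Frame P s′ s″ → Frame P s s″
  Frame-trans F G = record
    { nat  = λ y h → ≡.trans (Frame.nat G y h) (Frame.nat F y h)
    ; real = λ y h → ≡.trans (Frame.real G y h) (Frame.real F y h) }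

  -- `stable` says that the invariant ignores the counter cell, so neither its initialisation nor
  -- its increment can break it. The body also receives a frame back to the state before the loop,
  -- which lets invariants refer to the original arrays.
  run-for : ∀ {ℓ x y P s m} (I : ℕ → State → Set ℓ) →
            writesNat x P ≡ false → writesNat y (for x y P) ≡ false →
            nats s y 0 ≡ m → m ℕ.≤ H →
            (∀ i s k → I i s → I i (writeNat x 0 k s)) →
            I 0 s →
            (∀ i s′ → i ℕ.< m → Frame (for x y P) s s′ → nats s′ x 0 ≡ i → I i s′ → Run P s′ (I (suc i))) →
            Run (for x y P) s (I m)
  run-for {ℓ} {x} {y} {P} {s₀} {m} I x∉ y∉ y≡m m≤H stable I₀ body = start
    where
    body′ = P ﹔ increment x
    test = lit 1 ⊕ scalar x ≤ⁿ scalar y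
    c = cost body′

    hit : ∀ {s} k → nats (writeNat x 0 k s) x 0 ≡ k
    hit k rewrite ≡ᵇ-refl x = ≡.refl

    record Invariant (i : ℕ) (s : State) : Set (a ⊔ ℓ) where
      field
        counter : nats s x 0 ≡ i
        framed  : Frame (for x y P) s₀ s
        holds   : I i s

    limit : ∀ {s} → Frame (for x y P) s₀ s → nats s y 0 ≡ m
    limit F = ≡.trans (Frame.natCell F y y∉ 0) y≡m

    increment-frame : ∀ {s} k → Frame (for x y P) s (writeNat x 0 k s)
    increment-frame {s} k = record
      { nat  = λ z h → nats-write-miss x 0 k s (proj₁ (∨-false {x ≡ᵇ z} h))
      ; real = λ _ _ → ≡.refl }

    body-frame : ∀ {s s′} → Frame P s s′ → Frame (for x y P) s s′
    body-frame F = record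
      { nat  = λ z h → Frame.nat F z (proj₁ (∨-false (proj₂ (∨-false {x ≡ᵇ z} h))))
      ; real = λ z h → Frame.real F z (proj₁ (∨-false h)) }

    iterations : ∀ r i s → i ℕ.+ r ≡ m → Invariant i s →
      Σ[ s′ ∈ State ] Σ[ t ∈ ℕ ] (⟨ while test body′ , s ⟩⇓⟨ s′ , t ⟩ × t ℕ.≤ r ℕ.* suc (H ℕ.^ c) ℕ.+ 1 × I m s′)
    iterations zero i s eq J = s , 1 , ⇓while-false test≡false , ℕ.≤-refl ,
      ≡.subst (λ i → I i s) i≡m (Invariant.holds J)
      where
      i≡m = ≡.trans (≡.sym (ℕ.+-identityʳ i)) eq
      test≡false : ⟦ test ⟧ᵗ s ≡ false
      test≡false = ≡.trans (≡.cong₂ (λ i m → suc i ℕ.≤ᵇ m) (≡.trans (Invariant.counter J) i≡m) (limit (Invariant.framed J)))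
        (≮⇒test {m})
    iterations (suc r) i s eq J = s″ , _ , ⇓while-true test≡true (⇓seq D ⇓setNat) E , time≤ , q′
      where
      open ℕ.≤-Reasoning
      open Invariant J
      i<m : i ℕ.< m
      i<m = ≡.subst (i ℕ.<_) eq (ℕ.m<m+n i (s≤s z≤n))
      iteration : Run P s (I (suc i))
      iteration = body i s i<m framed counter holds
      open Run iteration renaming (final to s′; time to t; evaluation to D; bounded to t≤; post to q)
      x≡i : nats s′ x 0 ≡ i
      x≡i = ≡.trans (≡.cong (λ f → f 0) (nats-frame D x x∉)) counter
      rest = iterations r (suc i) (writeNat x 0 (suc (nats s′ x 0)) s′) (≡.trans (≡.sym (ℕ.+-suc i r)) eq)
            (record
              { counter = ≡.trans (hit {s′} _) (≡.cong suc x≡i)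
              ; framed  = Frame-trans framed (Frame-trans (body-frame (frame D)) (increment-frame {s′} _))
              ; holds   = stable (suc i) s′ _ q })
      s″ = proj₁ rest
      u  = proj₁ (proj₂ rest)
      E  = proj₁ (proj₂ (proj₂ rest))
      u≤ = proj₁ (proj₂ (proj₂ (proj₂ rest)))
      q′ = proj₂ (proj₂ (proj₂ (proj₂ rest)))
      test≡true : ⟦ test ⟧ᵗ s ≡ true
      test≡true = ≡.trans (≡.cong₂ (λ i m → suc i ℕ.≤ᵇ m) counter (limit framed)) (<⇒test i<m)
      t+1≤ : t ℕ.+ 1 ℕ.≤ H ℕ.^ c
      t+1≤ = double (cost P ℕ.+ 0) (ℕ.≤-trans t≤ (H^-mono (ℕ.m≤m+n (cost P) 0))) (H^≥1 (cost P ℕ.+ 0))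
      time≤ : suc ((t ℕ.+ 1) ℕ.+ u) ℕ.≤ suc r ℕ.* suc (H ℕ.^ c) ℕ.+ 1
      time≤ = begin
        suc (t ℕ.+ 1) ℕ.+ u                                 ≤⟨ ℕ.+-mono-≤ (s≤s t+1≤) u≤ ⟩
        suc (H ℕ.^ c) ℕ.+ (r ℕ.* suc (H ℕ.^ c) ℕ.+ 1)       ≡⟨ ℕ.+-assoc (suc (H ℕ.^ c)) _ 1 ⟨
        suc r ℕ.* suc (H ℕ.^ c) ℕ.+ 1                       ∎

    -- The three extra factors `H` absorb the test in each round, the number of rounds, and the
    -- final failing test.
    loop-time : ∀ {t} → t ℕ.≤ m ℕ.* suc (H ℕ.^ c) ℕ.+ 1 → t ℕ.≤ H ℕ.^ (3 ℕ.+ c)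
    loop-time t≤ = ℕ.≤-trans t≤ (double (2 ℕ.+ c)
      (ℕ.*-mono-≤ m≤H (double c (H^≥1 c) ℕ.≤-refl)) (H^≥1 (2 ℕ.+ c)))

    start : Run (for x y P) s₀ (I m)
    start with iterations m 0 (writeNat x 0 0 s₀) ≡.refl
      (record { counter = hit {s₀} 0 ; framed = increment-frame {s₀} 0 ; holds = stable 0 s₀ 0 I₀ })
    ... | s′ , t , D , t≤ , q = run (⇓seq ⇓setNat D) (double (3 ℕ.+ c) (H^≥1 (3 ℕ.+ c)) (loop-time t≤)) q

  run-map : ∀ {ℓ ℓ′ P s} {Q : State → Set ℓ} {Q′ : State → Set ℓ′} → Run P s Q →
            (∀ s′ → Frame P s s′ → Q s′ → Q′ s′) → Run P s Q′
  run-map (run D t≤ q) f = run D t≤ (f _ (frame D) q)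

  real-hit : ∀ x i j r s → reals (writeReal x i j r s) x i j ≡ r
  real-hit x i j r s rewrite ≡ᵇ-refl x | ≡ᵇ-refl i | ≡ᵇ-refl j = ≡.refl

  real-miss-column : ∀ x i j r s k {l} → j ≢ l → reals (writeReal x i j r s) x k l ≡ reals s x k l
  real-miss-column x i j r s k j≢l rewrite ≢⇒≡ᵇ-false j≢l | ≡ᵇ-refl x with i ≡ᵇ k
  ... | true  = ≡.refl
  ... | false = ≡.refl

  real-miss-row : ∀ x i j r s {k} → i ≢ k → reals (writeReal x i j r s) x k ≡ reals s x k
  real-miss-row x i j r s i≢k rewrite ≢⇒≡ᵇ-false i≢k | ≡ᵇ-refl x = ≡.refl

  nat-hit : ∀ x i m s → nats (writeNat x i m s) x i ≡ m
  nat-hit x i m s rewrite ≡ᵇ-refl x | ≡ᵇ-refl i = ≡.refl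

  nat-miss : ∀ x i m s {k} → i ≢ k → nats (writeNat x i m s) x k ≡ nats s x k
  nat-miss x i m s i≢k rewrite ≢⇒≡ᵇ-false i≢k | ≡ᵇ-refl x = ≡.refl

-- The spanner program

-- Natural number variables: 0 is d, 1 is n, 2 the multiplicities, 3 the
-- outer loop, 4 a row, 5 a column, 6 the pivot row, 7 the pivot column.
-- Real variables: 0 the rows, 1 the weights, 2 the row p driving a
-- transformation, 3 its multipliers, 4 the pivot sums, 5 the carry, 6 the
-- scale of the initial carry.

entryAt : Name → Name → RealExp
entryAt v j = cell 0 (scalar v) (scalar j)

vectorAt : Name → NatExp → RealExp
vectorAt x e = cell x (lit 0) e

square : RealExp → RealExp
square e = e ⊠ e

-- The second assignment reads the entry just overwritten: the carry accumulates multiples of the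
-- new row, as in `carry`.
transformEntry : Program
transformEntry =
  setReal 0 (scalar 4) (scalar 5) (entryAt 4 5 ⊟ vectorAt 2 (scalar 5) ⊠ vectorAt 5 (lit 0)) ﹔
  setReal 5 (lit 0) (lit 0) (vectorAt 5 (lit 0) ⊞ vectorAt 3 (scalar 5) ⊠ entryAt 4 5)

-- One routine serves both phases. Elimination has scale 1 / pivot and zero multipliers, so the
-- carry stays at its initial quotient; insertion has scale zero. The column-7 entry is saved in the
-- carry before the row is overwritten.
transformRow : Program
transformRow = setReal 5 (lit 0) (lit 0) (entryAt 4 7 ⊠ vectorAt 6 (lit 0)) ﹔ for 5 0 transformEntry

transformRows : Program
transformRows = for 4 1 transformRow

compareRow : Program
compareRow = ifte (square (entryAt 4 7) ≤ʳ square (entryAt 6 7)) skip (setNat 6 (lit 0) (scalar 4))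

searchPivot : Program
searchPivot = setNat 6 (lit 0) (lit 0) ﹔ for 4 1 compareRow

select : Name → Program
select x = setNat 2 (scalar x) (lit 1 ⊕ cell 2 (scalar x))

copyPivot : Program
copyPivot = for 5 0 (setReal 2 (lit 0) (scalar 5) (entryAt 6 5))

-- The pivot row and the inverse of the pivot are saved first, since `transformRows` overwrites the
-- pivot row as well. Subtracting `𝟏` at the pivot column turns the copy into W b - δ k.
eliminate : Program
eliminate =
  setReal 1 (lit 0) (scalar 7) 𝟏 ﹔
  select 6 ﹔
  setReal 6 (lit 0) (lit 0) (inv (entryAt 6 7)) ﹔
  copyPivot ﹔
  setReal 2 (lit 0) (scalar 7) (vectorAt 2 (scalar 7) ⊟ 𝟏) ﹔
  transformRows

-- The column index is d - (1 + i), so columns run from last to first. Real tests offer only `≤ʳ`; a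
-- zero pivot is detected by its square, and as the pivot has the largest square, the whole column
-- then vanishes.
processColumn : Program
processColumn =
  setNat 7 (lit 0) (scalar 0 ⊖ (lit 1 ⊕ scalar 3)) ﹔
  searchPivot ﹔
  ifte (square (entryAt 6 7) ≤ʳ 𝟎) skip eliminate

sumPivots : Program
sumPivots =
  setReal 4 (lit 0) (lit 0) 𝟏 ﹔
  for 5 0 (setReal 4 (lit 0) (lit 1 ⊕ scalar 5)
    (vectorAt 4 (scalar 5) ⊞ square (entryAt 3 5) ⊠ inv (vectorAt 1 (scalar 5))))

-- The weight is overwritten last because the multiplier needs the old one; the pivot sums were
-- computed beforehand from the old weights.
updateWeight : Program
updateWeight =
  setReal 2 (lit 0) (scalar 5) (entryAt 3 5) ﹔
  setReal 3 (lit 0) (scalar 5) (vectorAt 2 (scalar 5) ⊠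
    inv (vectorAt 4 (scalar 5) ⊠ vectorAt 1 (scalar 5) ⊞ square (vectorAt 2 (scalar 5)))) ﹔
  setReal 1 (lit 0) (scalar 5) (vectorAt 1 (scalar 5) ⊞
    square (vectorAt 2 (scalar 5)) ⊠ inv (vectorAt 4 (scalar 5)))

insert : Program
insert =
  select 3 ﹔
  setReal 6 (lit 0) (lit 0) 𝟎 ﹔
  for 5 0 updateWeight ﹔
  transformRows

processRow : Program
processRow = sumPivots ﹔ ifte (vectorAt 4 (scalar 0) ≤ʳ 𝟏 ⊞ 𝟏) skip insert

-- Row 0 is selected first, so that the output is nonempty even if V = {0}.
spanner : Program
spanner = ifte (lit 1 ≤ⁿ scalar 1)
  (setNat 2 (lit 0) (lit 1) ﹔ for 3 0 processColumn ﹔ for 3 1 processRow)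
  skip

-- The program maintains the invariants of both phases

module Correctness {a ℓ₁ ℓ₂} (R : Reals a ℓ₁ ℓ₂) (d n : ℕ) (1≤d : 1 ℕ.≤ d) (1≤n : 1 ℕ.≤ n) where

  H : ℕ
  H = d ℕ.+ n

  open Coordinates R d n
  open Elimination R d n
  open RankOneUpdate R d n
  open Execution R H (ℕ.+-mono-≤ 1≤d 1≤n)

  d≤H : d ℕ.≤ H
  d≤H = ℕ.m≤m+n d n

  n≤H : n ℕ.≤ H
  n≤H = ℕ.m≤n+m n d

  newRow-cong : ∀ {p p′ β β′ w w′ : Seq} {z z′} → p ≡ p′ → β ≡ β′ → w ≡ w′ → z ≡ z′ →
                ∀ j → newRow p β w z j ≡ newRow p′ β′ w′ z′ j
  newRow-cong ≡.refl ≡.refl ≡.refl ≡.refl j = ≡.refl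

  TransformedEntries : State → ℕ → ℕ → State → Set a
  TransformedEntries s v j s′ =
    reals s′ 5 0 0 ≡ carry p β w z j ×
    (∀ l → l ℕ.< j → reals s′ 0 v l ≡ newRow p β w z l) ×
    (∀ l → j ℕ.≤ l → reals s′ 0 v l ≡ w l) ×
    (∀ u → u ≢ v → reals s′ 0 u ≡ reals s 0 u)
    where
    p = reals s 2 0
    β = reals s 3 0
    w = reals s 0 v
    z = reals s 5 0 0

  run-transformEntries : ∀ s v → nats s 4 0 ≡ v → nats s 0 0 ≡ d →
                         Run (for 5 0 transformEntry) s (TransformedEntries s v d)
  run-transformEntries s v v≡ d≡ = run-for {x = 5} {y = 0} (TransformedEntries s v) ≡.refl ≡.refl d≡ d≤H (λ _ _ _ h → h)
    (≡.refl , (λ _ ()) , (λ _ _ → ≡.refl) , (λ _ _ → ≡.refl))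
    λ j s′ j<d F j≡ h → entry-step j s′ F j≡ h
    where
    p = reals s 2 0
    β = reals s 3 0
    w = reals s 0 v
    z = reals s 5 0 0
    entry-step : ∀ j s′ → Frame (for 5 0 transformEntry) s s′ → nats s′ 5 0 ≡ j → TransformedEntries s v j s′ →
                 Run transformEntry s′ (TransformedEntries s v (suc j))
    entry-step j s′ F ≡.refl (c≡ , done , todo , others) = real≔ run-setReal (c′≡ , done′ , todo′ , others′)
      where
      i = nats s′ 4 0
      i≡v : i ≡ v
      i≡v = ≡.trans (Frame.natCell F 4 ≡.refl 0) v≡
      value : Carrier
      value = reals s′ 0 i j - reals s′ 2 0 j * reals s′ 5 0 0
      s₁ : State
      s₁ = writeReal 0 i j value s′
      value≡ : value ≡ newRow p β w z j
      value≡ = ≡.cong₂ _-_ (≡.trans (≡.cong (λ i → reals s′ 0 i j) i≡v) (todo j ℕ.≤-refl))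
        (≡.cong₂ _*_ (≡.cong (λ f → f 0 j) (Frame.real F 2 ≡.refl)) c≡)
      at-v : ∀ l → reals s₁ 0 v l ≡ reals s₁ 0 i l
      at-v l = ≡.cong (λ i → reals s₁ 0 i l) (≡.sym i≡v)
      hit : reals s₁ 0 i j ≡ newRow p β w z j
      hit = ≡.trans (real-hit 0 i j value s′) value≡
      c′≡ : reals s₁ 5 0 0 + reals s₁ 3 0 j * reals s₁ 0 i j ≡ carry p β w z (suc j)
      c′≡ = ≡.cong₂ _+_ c≡ (≡.cong₂ _*_ (≡.cong (λ f → f 0 j) (Frame.real F 3 ≡.refl)) hit)
      done′ : ∀ l → l ℕ.< suc j → reals s₁ 0 v l ≡ newRow p β w z l
      done′ l l≤j with ≤-suc-split l≤j
      ... | inj₂ ≡.refl = ≡.trans (at-v l) hit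
      ... | inj₁ l<j    = ≡.trans (real-miss-column 0 i j value s′ v (ℕ.>⇒≢ l<j)) (done l l<j)
      todo′ : ∀ l → suc j ℕ.≤ l → reals s₁ 0 v l ≡ w l
      todo′ l j<l = ≡.trans (real-miss-column 0 i j value s′ v (ℕ.<⇒≢ j<l)) (todo l (ℕ.<⇒≤ j<l))
      others′ : ∀ u → u ≢ v → reals s₁ 0 u ≡ reals s 0 u
      others′ u u≢v = ≡.trans (real-miss-row 0 i j value s′ (λ i≡u → u≢v (≡.trans (≡.sym i≡u) i≡v))) (others u u≢v)

  Transformed : State → ℕ → State → Set a
  Transformed s u s′ =
    (∀ v → v ℕ.< u → ∀ j → j ℕ.< d → reals s′ 0 v j ≡
       newRow (reals s 2 0) (reals s 3 0) (reals s 0 v) (reals s 0 v (nats s 7 0) * reals s 6 0 0) j) ×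
    (∀ v → u ℕ.≤ v → reals s′ 0 v ≡ reals s 0 v)

  run-transformRows : ∀ s → nats s 0 0 ≡ d → nats s 1 0 ≡ n → Run transformRows s (Transformed s n)
  run-transformRows s d≡ n≡ = run-for {x = 4} {y = 1} (Transformed s) ≡.refl ≡.refl n≡ n≤H (λ _ _ _ h → h)
    ((λ _ ()) , (λ _ _ → ≡.refl))
    λ v s′ v<n F v≡ h → real≔ run-map (run-transformEntries _ v v≡ (≡.trans (Frame.natCell F 0 ≡.refl 0) d≡))
      (λ s″ _ → row-step v s′ F v≡ h s″)
    where
    row-step : ∀ v s′ → Frame transformRows s s′ → nats s′ 4 0 ≡ v → Transformed s v s′ → ∀ s″ →
      TransformedEntries (writeReal 5 0 0 (reals s′ 0 (nats s′ 4 0) (nats s′ 7 0) * reals s′ 6 0 0) s′) v d s″ →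
      Transformed s (suc v) s″
    row-step v s′ F ≡.refl (done , todo) s″ (_ , entries , _ , others) = done′ , todo′
      where
      done′ : ∀ u → u ℕ.< suc v → ∀ j → j ℕ.< d → reals s″ 0 u j ≡ _
      done′ u u≤v j j<d with ≤-suc-split u≤v
      ... | inj₂ ≡.refl = ≡.trans (entries j j<d) (newRow-cong
              (≡.cong (λ f → f 0) (Frame.real F 2 ≡.refl)) (≡.cong (λ f → f 0) (Frame.real F 3 ≡.refl))
              (todo u ℕ.≤-refl)
              (≡.cong₂ _*_ (≡.cong₂ (λ f k → f k) (todo u ℕ.≤-refl) (Frame.natCell F 7 ≡.refl 0))
                (≡.cong (λ f → f 0 0) (Frame.real F 6 ≡.refl))) j)
      ... | inj₁ u<v = ≡.trans (≡.cong (λ f → f j) (others u (ℕ.<⇒≢ u<v))) (done u u<v j j<d)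
      todo′ : ∀ u → suc v ℕ.≤ u → reals s″ 0 u ≡ reals s 0 u
      todo′ u v<u = ≡.trans (others u (ℕ.>⇒≢ v<u)) (todo u (ℕ.<⇒≤ v<u))

  test-true : ∀ p q s → ⟦ p ≤ʳ q ⟧ᵗ s ≡ true → ⟦ p ⟧ʳ s ≤ ⟦ q ⟧ʳ s
  test-true p q s eq with ⟦ p ⟧ʳ s ≤? ⟦ q ⟧ʳ s
  ... | yes h = h
  test-true p q s () | no _

  test-false : ∀ p q s → ⟦ p ≤ʳ q ⟧ᵗ s ≡ false → ¬ (⟦ p ⟧ʳ s ≤ ⟦ q ⟧ʳ s)
  test-false p q s eq with ⟦ p ⟧ʳ s ≤? ⟦ q ⟧ʳ s
  ... | no h = h
  test-false p q s () | yes _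

  Maximal : Rows → ℕ → ℕ → State → Set ℓ₂
  Maximal W k u s = Σ[ b ∈ ℕ ] (nats s 6 0 ≡ b × b ℕ.< n × (∀ v → v ℕ.< u → sq (W v k) ≤ sq (W b k)))

  run-searchPivot : ∀ s → nats s 1 0 ≡ n → Run searchPivot s (Maximal (reals s 0) (nats s 7 0) n)
  run-searchPivot s n≡ = nat≔ run-for {x = 4} {y = 1} (Maximal W k) ≡.refl ≡.refl n≡ n≤H (λ _ _ _ h → h)
    (0 , ≡.refl , 1≤n , λ _ ()) body
    where
    W = reals s 0
    k = nats s 7 0
    s₁ = writeNat 6 0 0 s
    body : ∀ v s′ → v ℕ.< n → Frame (for 4 1 compareRow) s₁ s′ → nats s′ 4 0 ≡ v → Maximal W k v s′ →
           Run compareRow s′ (Maximal W k (suc v))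
    body v s′ v<n F v≡ (b , b≡ , b<n , max) = run-if
      (λ eq → run-skip (b , b≡ , b<n , λ u u≤v → keep (≡.subst₂ _≤_ (square-at v≡) (square-at b≡) (test-true left right s′ eq)) u (≤-suc-split u≤v)))
      (λ eq → run-setNat (v , v≡ , v<n , λ u u≤v → replace (≡.subst₂ _≤_ (square-at b≡) (square-at v≡) (≰⇒≥ (test-false left right s′ eq))) u (≤-suc-split u≤v)))
      where
      left right : RealExp
      left  = square (entryAt 4 7)
      right = square (entryAt 6 7)
      square-at : ∀ {x u} → nats s′ x 0 ≡ u → sq (reals s′ 0 (nats s′ x 0) (nats s′ 7 0)) ≡ sq (W u k)
      square-at x≡u = ≡.cong sq (≡.trans (≡.cong₂ (reals s′ 0) x≡u (Frame.natCell F 7 ≡.refl 0))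
        (≡.cong (λ f → f _ k) (Frame.real F 0 ≡.refl)))
      keep : sq (W v k) ≤ sq (W b k) → ∀ u → u ℕ.< v ⊎ u ≡ v → sq (W u k) ≤ sq (W b k)
      keep h u (inj₁ u<v)    = max u u<v
      keep h u (inj₂ ≡.refl) = h
      replace : sq (W b k) ≤ sq (W v k) → ∀ u → u ℕ.< v ⊎ u ≡ v → sq (W u k) ≤ sq (W v k)
      replace h u (inj₁ u<v)    = ≤-trans (max u u<v) h
      replace h u (inj₂ ≡.refl) = ≤-refl

  Copied : Seq → ℕ → State → Set a
  Copied w j s′ = ∀ l → l ℕ.< j → reals s′ 2 0 l ≡ w l

  run-copyPivot : ∀ s → nats s 0 0 ≡ d → Run copyPivot s (Copied (reals s 0 (nats s 6 0)) d)
  run-copyPivot s d≡ = run-for {x = 5} {y = 0} (Copied w) ≡.refl ≡.refl d≡ d≤H (λ _ _ _ h → h) (λ _ ())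
    λ { j s′ j<d F ≡.refl h → run-setReal (copy-step s′ F h) }
    where
    w = reals s 0 (nats s 6 0)
    copy-step : ∀ s′ → Frame copyPivot s s′ → Copied w (nats s′ 5 0) s′ →
      Copied w (suc (nats s′ 5 0)) (writeReal 2 0 (nats s′ 5 0) (reals s′ 0 (nats s′ 6 0) (nats s′ 5 0)) s′)
    copy-step s′ F h l l≤j with ≤-suc-split l≤j
    ... | inj₂ ≡.refl = ≡.trans (real-hit 2 0 l (reals s′ 0 (nats s′ 6 0) l) s′)
            (≡.cong₂ (λ W b → W b l) (Frame.real F 0 ≡.refl) (Frame.natCell F 6 ≡.refl 0))
    ... | inj₁ l<j    = ≡.trans (real-miss-column 2 0 (nats s′ 5 0) (reals s′ 0 (nats s′ 6 0) (nats s′ 5 0)) s′ 0 (ℕ.>⇒≢ l<j)) (h l l<j)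

  run-increment : ∀ b s → Increments b (nats s 2) (nats (writeNat 2 b (suc (nats s 2 b)) s) 2)
  run-increment b s = nat-hit 2 b _ s , λ v v≢b → nat-miss 2 b _ s (v≢b ∘ ≡.sym)

  Eliminated : State → State → Set ℓ₁
  Eliminated s s′ =
    (∀ v j → v ℕ.< n → j ℕ.< d → reals s′ 0 v j ≈ W v j - (W b j - δ k j) * (W v k * (W b k) ⁻¹)) ×
    reals s′ 1 0 k ≈ 1# × (∀ j → j ≢ k → reals s′ 1 0 j ≈ reals s 1 0 j) ×
    Increments b (nats s 2) (nats s′ 2)
    where
    W = reals s 0
    b = nats s 6 0
    k = nats s 7 0

  run-eliminate : ∀ s → nats s 0 0 ≡ d → nats s 1 0 ≡ n → (∀ j → reals s 3 0 j ≈ 0#) →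
                  Run eliminate s (Eliminated s)
  run-eliminate s d≡ n≡ β≈0 = real≔ nat≔ real≔ run-seq (run-copyPivot s₃ d≡) (λ s₄ F copied →
    real≔ run-map (run-transformRows (s₅ s₄) (≡.trans (Frame.natCell F 0 ≡.refl 0) d≡) (≡.trans (Frame.natCell F 1 ≡.refl 0) n≡))
      (λ s₆ G (rows , _) → post s₄ F copied s₆ G rows))
    where
    W = reals s 0
    b = nats s 6 0
    k = nats s 7 0
    s₁ s₂ s₃ : State
    s₁ = writeReal 1 0 k 1# s
    s₂ = writeNat 2 b (suc (nats s 2 b)) s₁
    s₃ = writeReal 6 0 0 ((W b k) ⁻¹) s₂
    s₅ : State → State
    s₅ s₄ = writeReal 2 0 (nats s₄ 7 0) (reals s₄ 2 0 (nats s₄ 7 0) - 1#) s₄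
    post : ∀ s₄ → Frame copyPivot s₃ s₄ → Copied (W b) d s₄ → ∀ s₆ → Frame transformRows (s₅ s₄) s₆ →
      (∀ v → v ℕ.< n → ∀ j → j ℕ.< d → reals s₆ 0 v j ≡
        newRow (reals (s₅ s₄) 2 0) (reals s₄ 3 0) (reals s₄ 0 v) (reals s₄ 0 v (nats s₄ 7 0) * reals s₄ 6 0 0) j) →
      Eliminated s s₆
    post s₄ F copied s₆ G rows = row , weight , weights , inc
      where
      k≡ : nats s₄ 7 0 ≡ k
      k≡ = Frame.natCell F 7 ≡.refl 0
      W≡ : reals s₄ 0 ≡ W
      W≡ = Frame.real F 0 ≡.refl
      x = reals s₄ 2 0 (nats s₄ 7 0) - 1#
      p≈ : ∀ j → j ℕ.< d → reals (s₅ s₄) 2 0 j ≈ W b j - δ k j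
      p≈ j j<d with nats s₄ 7 0 ℕ.≟ j
      ... | yes ≡.refl = begin-equality
              reals (s₅ s₄) 2 0 j          ≡⟨ real-hit 2 0 j x s₄ ⟩
              reals s₄ 2 0 j - 1#          ≈⟨ +-cong (reflexive (copied j j<d)) (-‿cong (reflexive (≡.sym (≡.trans (≡.cong (δ k) k≡) (δ-diagonal k))))) ⟩
              W b j - δ k j                ∎
        where open ≤-Reasoning
      ... | no  k≢j    = begin-equality
              reals (s₅ s₄) 2 0 j          ≡⟨ real-miss-column 2 0 (nats s₄ 7 0) x s₄ 0 k≢j ⟩
              reals s₄ 2 0 j               ≡⟨ copied j j<d ⟩
              W b j                        ≈⟨ solve 1 (λ x → x := x :- con (0 , 0)) refl _ ⟩
              W b j - 0#                   ≡⟨ ≡.cong (λ e → W b j - e) (δ-off (λ j≡k → k≢j (≡.trans k≡ (≡.sym j≡k)))) ⟨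
              W b j - δ k j                ∎
        where open ≤-Reasoning
      row : ∀ v j → v ℕ.< n → j ℕ.< d → reals s₆ 0 v j ≈ W v j - (W b j - δ k j) * (W v k * (W b k) ⁻¹)
      -- The multipliers are still zero in this phase, so the carry keeps its initial value, the
      -- entry divided by the pivot.
      row v j v<n j<d = trans (reflexive (rows v v<n j j<d))
        (+-cong (reflexive (≡.cong (λ W → W v j) W≡)) (-‿cong (*-cong (p≈ j j<d)
          (trans (carry-zero (λ j → trans (reflexive (≡.cong (λ f → f 0 j) (Frame.real F 3 ≡.refl))) (β≈0 j)) j)
            (*-cong (reflexive (≡.cong₂ (λ W k → W v k) W≡ k≡)) (reflexive (≡.cong (λ f → f 0 0) (Frame.real F 6 ≡.refl))))))))
      D≡ : reals s₆ 1 ≡ reals s₁ 1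
      D≡ = ≡.trans (Frame.real G 1 ≡.refl) (Frame.real F 1 ≡.refl)
      weight : reals s₆ 1 0 k ≈ 1#
      weight = reflexive (≡.trans (≡.cong (λ f → f 0 k) D≡) (real-hit 1 0 k 1# s))
      weights : ∀ j → j ≢ k → reals s₆ 1 0 j ≈ reals s 1 0 j
      weights j j≢k = reflexive (≡.trans (≡.cong (λ f → f 0 j) D≡) (real-miss-column 1 0 k 1# s 0 (j≢k ∘ ≡.sym)))
      inc : Increments b (nats s 2) (nats s₆ 2)
      inc = ≡.subst (Increments b (nats s 2)) (≡.sym (≡.trans (Frame.nat G 2 ≡.refl) (Frame.nat F 2 ≡.refl))) (run-increment b s₁)

  run-sumPivots : ∀ s → nats s 0 0 ≡ d → Run sumPivots s (λ s′ → ∀ l → l ℕ.≤ d →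
                  reals s′ 4 0 l ≡ pivotSum (reals s 1 0) (reals s 0 (nats s 3 0)) l)
  run-sumPivots s d≡ = real≔ run-for {x = 5} {y = 0} Summed ≡.refl ≡.refl d≡ d≤H (λ _ _ _ h → h)
    (λ { zero z≤n → ≡.refl })
    λ { j s′ j<d F ≡.refl h → run-setReal (sum-step s′ F h) }
    where
    D = reals s 1 0
    w = reals s 0 (nats s 3 0)
    body : Program
    body = setReal 4 (lit 0) (lit 1 ⊕ scalar 5) (vectorAt 4 (scalar 5) ⊞ square (entryAt 3 5) ⊠ inv (vectorAt 1 (scalar 5)))
    Summed : ℕ → State → Set a
    Summed j s′ = ∀ l → l ℕ.≤ j → reals s′ 4 0 l ≡ pivotSum D w l
    value : State → Carrier
    value s′ = reals s′ 4 0 j + sq (reals s′ 0 (nats s′ 3 0) j) * reals s′ 1 0 j ⁻¹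
      where j = nats s′ 5 0
    sum-step : ∀ s′ → Frame (for 5 0 body) (writeReal 4 0 0 1# s) s′ → Summed (nats s′ 5 0) s′ →
      Summed (suc (nats s′ 5 0)) (writeReal 4 0 (suc (nats s′ 5 0)) (value s′) s′)
    sum-step s′ F h l l≤1+j with ℕ.m≤n⇒m<n∨m≡n l≤1+j
    ... | inj₁ (s≤s l≤j) = ≡.trans (real-miss-column 4 0 (suc (nats s′ 5 0)) (value s′) s′ 0 (ℕ.>⇒≢ (s≤s l≤j))) (h l l≤j)
    ... | inj₂ ≡.refl    = ≡.trans (real-hit 4 0 (suc j) (value s′) s′)
            (≡.cong₂ _+_ (h j ℕ.≤-refl) (≡.cong₂ _*_
              (≡.cong sq (≡.cong₂ (λ W u → W u j) (Frame.real F 0 ≡.refl) (Frame.natCell F 3 ≡.refl 0)))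
              (≡.cong (λ f → f 0 j ⁻¹) (Frame.real F 1 ≡.refl))))
      where j = nats s′ 5 0

  Reweighted : State → ℕ → State → Set a
  Reweighted s j s′ =
    (∀ l → l ℕ.< j → reals s′ 2 0 l ≡ w l × reals s′ 3 0 l ≡ w l * (t l * D l + sq (w l)) ⁻¹ ×
                     reals s′ 1 0 l ≡ D l + sq (w l) * (t l) ⁻¹) ×
    (∀ l → j ℕ.≤ l → reals s′ 1 0 l ≡ D l)
    where
    D = reals s 1 0
    t = reals s 4 0
    w = reals s 0 (nats s 3 0)

  run-updateWeights : ∀ s → nats s 0 0 ≡ d → Run (for 5 0 updateWeight) s (Reweighted s d)
  run-updateWeights s d≡ = run-for {x = 5} {y = 0} (Reweighted s) ≡.refl ≡.refl d≡ d≤H (λ _ _ _ h → h)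
    ((λ _ ()) , λ _ _ → ≡.refl)
    λ { j s′ j<d F ≡.refl h → real≔ real≔ run-setReal (weight-step s′ F h) }
    where
    D = reals s 1 0
    t = reals s 4 0
    w = reals s 0 (nats s 3 0)
    weight-step : ∀ s′ → Frame (for 5 0 updateWeight) s s′ → Reweighted s (nats s′ 5 0) s′ →
      let j  = nats s′ 5 0
          s₁ = writeReal 2 0 j (reals s′ 0 (nats s′ 3 0) j) s′
          s₂ = writeReal 3 0 j (reals s₁ 2 0 j * (reals s′ 4 0 j * reals s′ 1 0 j + sq (reals s₁ 2 0 j)) ⁻¹) s₁
      in Reweighted s (suc j) (writeReal 1 0 j (reals s′ 1 0 j + sq (reals s₁ 2 0 j) * (reals s′ 4 0 j) ⁻¹) s₂)
    weight-step s′ F (done , todo) = done′ , todo′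
      where
      j = nats s′ 5 0
      x = reals s′ 0 (nats s′ 3 0) j
      s₁ = writeReal 2 0 j x s′
      y = reals s₁ 2 0 j * (reals s′ 4 0 j * reals s′ 1 0 j + sq (reals s₁ 2 0 j)) ⁻¹
      s₂ = writeReal 3 0 j y s₁
      z = reals s′ 1 0 j + sq (reals s₁ 2 0 j) * (reals s′ 4 0 j) ⁻¹
      s₃ = writeReal 1 0 j z s₂
      x≡ : x ≡ w j
      x≡ = ≡.cong₂ (λ W u → W u j) (Frame.real F 0 ≡.refl) (Frame.natCell F 3 ≡.refl 0)
      p≡ : reals s₁ 2 0 j ≡ w j
      p≡ = ≡.trans (real-hit 2 0 j x s′) x≡
      t≡ : reals s′ 4 0 j ≡ t j
      t≡ = ≡.cong (λ f → f 0 j) (Frame.real F 4 ≡.refl)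
      D≡ : reals s′ 1 0 j ≡ D j
      D≡ = todo j ℕ.≤-refl
      done′ : ∀ l → l ℕ.< suc j → reals s₃ 2 0 l ≡ w l × reals s₃ 3 0 l ≡ w l * (t l * D l + sq (w l)) ⁻¹ ×
                     reals s₃ 1 0 l ≡ D l + sq (w l) * (t l) ⁻¹
      done′ l l≤j with ≤-suc-split l≤j
      ... | inj₂ ≡.refl = p≡
            , ≡.trans (real-hit 3 0 j y s₁) (≡.cong₂ (λ p q → p * q ⁻¹) p≡ (≡.cong₂ _+_ (≡.cong₂ _*_ t≡ D≡) (≡.cong sq p≡)))
            , ≡.trans (real-hit 1 0 j z s₂) (≡.cong₂ _+_ D≡ (≡.cong₂ (λ p q → sq p * q ⁻¹) p≡ t≡))
      ... | inj₁ l<j = let (p , β , D′) = done l l<j in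
              ≡.trans (real-miss-column 2 0 j x s′ 0 (ℕ.>⇒≢ l<j)) p
            , ≡.trans (real-miss-column 3 0 j y s₁ 0 (ℕ.>⇒≢ l<j)) β
            , ≡.trans (real-miss-column 1 0 j z s₂ 0 (ℕ.>⇒≢ l<j)) D′
      todo′ : ∀ l → suc j ℕ.≤ l → reals s₃ 1 0 l ≡ D l
      todo′ l j<l = ≡.trans (real-miss-column 1 0 j z s₂ 0 (ℕ.<⇒≢ j<l)) (todo l (ℕ.<⇒≤ j<l))

  -- The arrays written by the program agree with the mathematical sequences only below `d`.
  carry-local : ∀ {p p′ β β′ w z} → (∀ j → j ℕ.< d → p j ≡ p′ j × β j ≡ β′ j) →
                ∀ j → j ℕ.≤ d → carry p β w z j ≡ carry p′ β′ w z j
  carry-local eq zero    _   = ≡.refl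
  carry-local {w = w} {z} eq (suc j) j<d with eq j j<d | carry-local {w = w} {z} eq j (ℕ.<⇒≤ j<d)
  ... | p≡ , β≡ | c≡ = ≡.cong₂ _+_ c≡ (≡.cong₂ _*_ β≡ (≡.cong (λ e → w j - e) (≡.cong₂ _*_ p≡ c≡)))

  newRow-local : ∀ {p p′ β β′ w z} → (∀ j → j ℕ.< d → p j ≡ p′ j × β j ≡ β′ j) →
                 ∀ j → j ℕ.< d → newRow p β w z j ≡ newRow p′ β′ w z j
  newRow-local {w = w} eq j j<d = ≡.cong (λ e → w j - e) (≡.cong₂ _*_ (proj₁ (eq j j<d)) (carry-local eq j (ℕ.<⇒≤ j<d)))

  Inserted : State → State → Set (a ⊔ ℓ₁)
  Inserted s s′ =
    (∀ v → v ℕ.< n → Σ[ z ∈ Carrier ] (z ≈ 0# ×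
       (∀ j → j ℕ.< d → reals s′ 0 v j ≈ newRow (W u) (multiplier D (W u)) (W v) z j))) ×
    (∀ j → j ℕ.< d → reals s′ 1 0 j ≈ newWeight D (W u) j) ×
    Increments u (nats s 2) (nats s′ 2)
    where
    W = reals s 0
    D = reals s 1 0
    u = nats s 3 0

  run-insert : ∀ s → nats s 0 0 ≡ d → nats s 1 0 ≡ n →
               (∀ l → l ℕ.≤ d → reals s 4 0 l ≡ pivotSum (reals s 1 0) (reals s 0 (nats s 3 0)) l) →
               Run insert s (Inserted s)
  run-insert s d≡ n≡ t≡ = nat≔ real≔ run-seq (run-updateWeights s₂ d≡) (λ s₃ F reweighted →
    run-map (run-transformRows s₃ (≡.trans (Frame.natCell F 0 ≡.refl 0) d≡) (≡.trans (Frame.natCell F 1 ≡.refl 0) n≡))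
      (λ s₄ G (rows , _) → post s₃ F reweighted s₄ G rows))
    where
    W = reals s 0
    D = reals s 1 0
    u = nats s 3 0
    t = pivotSum D (W u)
    s₁ s₂ : State
    s₁ = writeNat 2 u (suc (nats s 2 u)) s
    s₂ = writeReal 6 0 0 0# s₁
    post : ∀ s₃ → Frame (for 5 0 updateWeight) s₂ s₃ → Reweighted s₂ d s₃ → ∀ s₄ → Frame transformRows s₃ s₄ →
      (∀ v → v ℕ.< n → ∀ j → j ℕ.< d → reals s₄ 0 v j ≡
        newRow (reals s₃ 2 0) (reals s₃ 3 0) (reals s₃ 0 v) (reals s₃ 0 v (nats s₃ 7 0) * reals s₃ 6 0 0) j) →
      Inserted s s₄
    post s₃ F (done , _) s₄ G rows = row , weight , inc
      where
      W≡ : reals s₃ 0 ≡ W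
      W≡ = Frame.real F 0 ≡.refl
      vectors : ∀ j → j ℕ.< d → reals s₃ 2 0 j ≡ W u j × reals s₃ 3 0 j ≡ multiplier D (W u) j
      vectors j j<d with done j j<d
      ... | p≡ , β≡ , _ = p≡ , ≡.trans β≡ (≡.cong (λ τ → W u j * (τ * D j + sq (W u j)) ⁻¹) (t≡ j (ℕ.<⇒≤ j<d)))
      row : ∀ v → v ℕ.< n → Σ[ z ∈ Carrier ] (z ≈ 0# ×
            (∀ j → j ℕ.< d → reals s₄ 0 v j ≈ newRow (W u) (multiplier D (W u)) (W v) z j))
      row v v<n = z , trans (*-congˡ (reflexive (≡.cong (λ f → f 0 0) (Frame.real F 6 ≡.refl)))) (zeroʳ _)
        , λ j j<d → reflexive (≡.trans (rows v v<n j j<d)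
            (≡.trans (newRow-local vectors j j<d) (newRow-cong ≡.refl ≡.refl (≡.cong (λ W → W v) W≡) ≡.refl j)))
        where z = reals s₃ 0 v (nats s₃ 7 0) * reals s₃ 6 0 0
      weight : ∀ j → j ℕ.< d → reals s₄ 1 0 j ≈ newWeight D (W u) j
      weight j j<d = reflexive (≡.trans (≡.cong (λ f → f 0 j) (Frame.real G 1 ≡.refl))
        (≡.trans (proj₂ (proj₂ (done j j<d))) (≡.cong (λ τ → D j + sq (W u j) * τ ⁻¹) (t≡ j (ℕ.<⇒≤ j<d)))))
      inc : Increments u (nats s 2) (nats s₄ 2)
      inc = ≡.subst (Increments u (nats s 2)) (≡.sym (≡.trans (Frame.nat G 2 ≡.refl) (Frame.nat F 2 ≡.refl))) (run-increment u s)

  module _ (V : Rows) where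

    State1 : ℕ → State → Set (a ⊔ ℓ₁ ⊔ ℓ₂)
    State1 i s = Phase1 V i (reals s 0) (reals s 1 0) (nats s 2)

    State2 : ℕ → State → Set (a ⊔ ℓ₁ ⊔ ℓ₂)
    State2 u s = Phase2 V u (reals s 0) (reals s 1 0) (nats s 2)

    transport : ∀ {ℓ} (Q : Rows → Rows → (ℕ → ℕ) → Set ℓ) {s s′} →
                reals s′ 0 ≡ reals s 0 → reals s′ 1 ≡ reals s 1 → nats s′ 2 ≡ nats s 2 →
                Q (reals s 0) (reals s 1) (nats s 2) → Q (reals s′ 0) (reals s′ 1) (nats s′ 2)
    transport Q W≡ D≡ m≡ q rewrite W≡ | D≡ | m≡ = q

    run-column : ∀ i s → nats s 0 0 ≡ d → nats s 1 0 ≡ n → nats s 7 0 ℕ.+ suc i ≡ d → (∀ j → reals s 3 0 j ≈ 0#) →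
                 State1 i s → Maximal (reals s 0) (nats s 7 0) n s →
                 Run (ifte (square (entryAt 6 7) ≤ʳ 𝟎) skip eliminate) s (State1 (suc i))
    run-column i s d≡ n≡ k≡ β≈0 I (b , ≡.refl , b<n , max) = run-if
      (λ eq → run-skip (skip-column k k≡ (λ v v<n → sq≤0⇒≈0 (≤-trans (max v v<n) (test-true (square (entryAt 6 7)) 𝟎 s eq))) I))
      (λ eq → run-map (run-eliminate s d≡ n≡ β≈0) (λ { s′ _ (row , hit , miss , inc) →
        Pivot.step k b (k<d k≡) b<n
          (λ ≈0 → test-false (square (entryAt 6 7)) 𝟎 s eq (≤-reflexive (trans (*-congˡ ≈0) (zeroʳ _))))
          max row hit miss inc k≡ I }))
      where k = nats s 7 0

    run-processColumn : ∀ i s → i ℕ.< d → nats s 0 0 ≡ d → nats s 1 0 ≡ n → nats s 3 0 ≡ i → (∀ j → reals s 3 0 j ≈ 0#) →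
                        State1 i s → Run processColumn s (State1 (suc i))
    run-processColumn i s i<d d≡ n≡ i≡ β≈0 I = nat≔ run-seq (run-searchPivot s₁ n≡) (λ s₂ F max →
      run-column i s₂ (≡.trans (Frame.natCell F 0 ≡.refl 0) d≡) (≡.trans (Frame.natCell F 1 ≡.refl 0) n≡)
        (≡.trans (≡.cong (ℕ._+ suc i) (Frame.natCell F 7 ≡.refl 0)) (≡.trans (≡.cong₂ (λ d j → (d ℕ.∸ suc j) ℕ.+ suc i) d≡ i≡) (ℕ.m∸n+n≡m i<d)))
        (λ j → trans (reflexive (≡.cong (λ f → f 0 j) (Frame.real F 3 ≡.refl))) (β≈0 j))
        (transport (λ W D m → Phase1 V i W (D 0) m) {s₁} {s₂} (Frame.real F 0 ≡.refl) (Frame.real F 1 ≡.refl) (Frame.nat F 2 ≡.refl) I)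
        (≡.subst₂ (λ W k → Maximal W k n s₂) (≡.sym (Frame.real F 0 ≡.refl)) (≡.sym (Frame.natCell F 7 ≡.refl 0)) max))
      where
      s₁ : State
      s₁ = writeNat 7 0 (nats s 0 0 ℕ.∸ suc (nats s 3 0)) s

    run-processRow : ∀ u s → u ℕ.< n → nats s 0 0 ≡ d → nats s 1 0 ≡ n → nats s 3 0 ≡ u →
                     State2 u s → Run processRow s (State2 (suc u))
    run-processRow u s u<n d≡ n≡ u≡ I = run-seq (run-sumPivots s d≡) (λ s′ F t≡ →
        decide u s′ u<n (≡.trans (Frame.natCell F 0 ≡.refl 0) d≡) (≡.trans (Frame.natCell F 1 ≡.refl 0) n≡)
          (≡.trans (Frame.natCell F 3 ≡.refl 0) u≡)
          (transport (λ W D m → Phase2 V u W (D 0) m) {s} {s′} (Frame.real F 0 ≡.refl) (Frame.real F 1 ≡.refl) (Frame.nat F 2 ≡.refl) I)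
          (λ l l≤d → ≡.trans (t≡ l l≤d) (≡.sym (≡.cong₂ (λ D w → pivotSum D w l)
            (≡.cong (λ f → f 0) (Frame.real F 1 ≡.refl))
            (≡.cong₂ (λ W u → W u) (Frame.real F 0 ≡.refl) (Frame.natCell F 3 ≡.refl 0))))))
      where
      decide : ∀ u s → u ℕ.< n → nats s 0 0 ≡ d → nats s 1 0 ≡ n → nats s 3 0 ≡ u → State2 u s →
               (∀ l → l ℕ.≤ d → reals s 4 0 l ≡ pivotSum (reals s 1 0) (reals s 0 (nats s 3 0)) l) →
               Run (ifte (vectorAt 4 (scalar 0) ≤ʳ 𝟏 ⊞ 𝟏) skip insert) s (State2 (suc u))
      decide u s u<n d≡ n≡ ≡.refl I t≡ = run-if
        (λ eq → run-skip (skip-row u<n (≡.subst (_≤ 1# + 1#) last≡ (test-true lastSum (𝟏 ⊞ 𝟏) s eq)) I))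
        (λ eq → run-map (run-insert s d≡ n≡ t≡) (λ { s′ _ (row , weight , inc) →
          Insert.step u 1≤d u<n
            (λ h → test-false lastSum (𝟏 ⊞ 𝟏) s eq (≡.subst (_≤ 1# + 1#) (≡.sym last≡) h))
            row weight inc I }))
        where
        lastSum : RealExp
        lastSum = vectorAt 4 (scalar 0)
        last≡ : reals s 4 0 (nats s 0 0) ≡ pivotSum (reals s 1 0) (reals s 0 u) d
        last≡ = ≡.trans (≡.cong (reals s 4 0) d≡) (t≡ d ℕ.≤-refl)

-- Linearity of xᵀ M x in M

module QuadraticForms {a ℓ₁ ℓ₂} (R : Reals a ℓ₁ ℓ₂) {d : ℕ} where

  open OrderedField R
  open Spanners R using (Vect; Matrix; outer)
  open Algebra.Properties.Semiring.Sum semiring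
    using (sum; sum-cong-≋; ∑-distrib-+; *-distribˡ-sum; *-distribʳ-sum; sum-replicate-zero)

  quadratic : Vect d → Matrix d → Carrier
  quadratic x M = sum (λ i → sum (λ j → x i * (M i j * x j)))

  quadratic-cong : ∀ x {M M′ : Matrix d} → (∀ i j → M i j ≈ M′ i j) → quadratic x M ≈ quadratic x M′
  quadratic-cong x eq = sum-cong-≋ (λ i → sum-cong-≋ (λ j → *-congˡ (*-congʳ (eq i j))))

  quadratic-+ : ∀ x (M M′ : Matrix d) → quadratic x (λ i j → M i j + M′ i j) ≈ quadratic x M + quadratic x M′
  quadratic-+ x M M′ = trans
    (sum-cong-≋ (λ i → trans
      (sum-cong-≋ (λ j → solve 4 (λ x m n y → x :* ((m :+ n) :* y) := x :* (m :* y) :+ x :* (n :* y)) refl (x i) (M i j) (M′ i j) (x j)))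
      (∑-distrib-+ {d} (λ j → x i * (M i j * x j)) (λ j → x i * (M′ i j * x j)))))
    (∑-distrib-+ {d} (λ i → sum (λ j → x i * (M i j * x j))) (λ i → sum (λ j → x i * (M′ i j * x j))))

  quadratic-* : ∀ x c (M : Matrix d) → quadratic x (λ i j → c * M i j) ≈ c * quadratic x M
  quadratic-* x c M = trans
    (sum-cong-≋ (λ i → trans
      (sum-cong-≋ (λ j → solve 4 (λ x c m y → x :* ((c :* m) :* y) := c :* (x :* (m :* y))) refl (x i) c (M i j) (x j)))
      (sym (*-distribˡ-sum {d} c (λ j → x i * (M i j * x j))))))
    (sym (*-distribˡ-sum {d} c (λ i → sum (λ j → x i * (M i j * x j)))))

  quadratic-sum : ∀ {k} x (w : Fin k → Carrier) (F : Fin k → Matrix d) →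
                  quadratic x (λ i j → sum (λ u → w u * F u i j)) ≈ sum (λ u → w u * quadratic x (F u))
  quadratic-sum {zero} x w F = trans
    (sum-cong-≋ (λ i → trans (sum-cong-≋ (λ j → trans (*-congˡ (zeroˡ (x j))) (zeroʳ (x i)))) (sum-replicate-zero d)))
    (sum-replicate-zero d)
  quadratic-sum {suc k} x w F = trans
    (quadratic-+ x (λ i j → w Fin.zero * F Fin.zero i j) (λ i j → sum (λ u → w (Fin.suc u) * F (Fin.suc u) i j)))
    (+-cong (quadratic-* x (w Fin.zero) (F Fin.zero)) (quadratic-sum x (w ∘ Fin.suc) (F ∘ Fin.suc)))

  quadratic-outer : ∀ x (v : Vect d) → quadratic x (outer v) ≈ sq (sum (λ i → x i * v i))
  quadratic-outer x v = trans
    (sum-cong-≋ (λ i → trans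
      (sum-cong-≋ (λ j → solve 4 (λ x v w y → x :* ((v :* w) :* y) := (x :* v) :* (y :* w)) refl (x i) (v i) (v j) (x j)))
      (sym (*-distribˡ-sum {d} (x i * v i) (λ j → x j * v j)))))
    (sym (*-distribʳ-sum {d} (sum (λ j → x j * v j)) (λ i → x i * v i)))

-- From the final state to a spectral spanner

module Assembly {a ℓ₁ ℓ₂} (R : Reals a ℓ₁ ℓ₂) (d n : ℕ) (1≤d : 1 ℕ.≤ d) (1≤n : 1 ℕ.≤ n) where

  open Coordinates R d n hiding (fromℕ)
  open Elimination R d n using (Phase1)
  open RankOneUpdate R d n using (Phase2; start)
  open Counting using (bound)
  open Correctness R d n 1≤d 1≤n
  open Execution R H (ℕ.+-mono-≤ 1≤d 1≤n)
  open Spanners R using (fromℕ)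
  open QuadraticForms R {d}
  open Algebra.Properties.Semiring.Sum semiring
    using (sum; sum-cong-≋; *-distribˡ-sum)

  module _ (V : Vector (Vect d) n) where

    initial : State
    initial = writeNat 2 0 1 (input V)

    initial-phase : State1 (entry V) 0 initial
    initial-phase = record
      { N         = 1
      ; 1≤N       = s≤s z≤n
      ; N≤1+i     = s≤s z≤n
      ; size      = S-single n 0 1≤n (λ { zero 0≢0 → ⊥-elim (0≢0 ≡.refl) ; (suc i) _ → refl })
      ; spans     = λ x → x , λ _ _ → refl
      ; dominated = λ g → ≤-respˡ (sym (S-zero d (λ _ _ → zeroˡ _)))
                      (S-nonNegative n (λ v _ → *-nonNegative (fromℕ-nonNegative (nats initial 2 v)) (sq-nonNegative _)))
      ; untouched = λ _ _ → refl
      ; columns   = λ k k<d d≤k → ⊥-elim (ℕ.<⇒≱ k<d (≡.subst (d ℕ.≤_) (ℕ.+-identityʳ k) d≤k))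
      }

    run-spanner : Run spanner (input V) (State2 (entry V) n)
    run-spanner = run-if
      (λ _ → nat≔ run-seq
        (run-for {x = 3} {y = 0} (State1 (entry V)) ≡.refl ≡.refl ≡.refl d≤H (λ _ _ _ h → h) initial-phase
          (λ i s i<d F i≡ I → run-processColumn (entry V) i s i<d (Frame.natCell F 0 ≡.refl 0) (Frame.natCell F 1 ≡.refl 0) i≡
            (λ j → reflexive (≡.cong (λ f → f 0 j) (Frame.real F 3 ≡.refl))) I))
        (λ s F I → run-for {x = 3} {y = 1} (State2 (entry V)) ≡.refl ≡.refl (Frame.natCell F 1 ≡.refl 0) n≤H (λ _ _ _ h → h) (start 1≤d I)
          (λ u s′ u<n G u≡ J → run-processRow (entry V) u s′ u<n
            (≡.trans (Frame.natCell G 0 ≡.refl 0) (Frame.natCell F 0 ≡.refl 0))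
            (≡.trans (Frame.natCell G 1 ≡.refl 0) (Frame.natCell F 1 ≡.refl 0)) u≡ J)))
      (λ eq → ⊥-elim (true≢false (≡.trans (≡.sym (<⇒test 1≤n)) eq)))
      where
      true≢false : true ≢ false
      true≢false ()

    entry-toℕ : ∀ u i → entry V (toℕ u) (toℕ i) ≡ V u i
    entry-toℕ u i with toℕ u ℕ.<? n | toℕ i ℕ.<? d
    ... | yes p | yes q = ≡.cong₂ V (Fin.fromℕ<-toℕ u p) (Fin.fromℕ<-toℕ i q)
    ... | yes _ | no ¬q = ⊥-elim (¬q (Fin.toℕ<n i))
    ... | no ¬p | _     = ⊥-elim (¬p (Fin.toℕ<n u))

    extend : Vect d → Seq
    extend x j with j ℕ.<? d
    ... | yes j<d = x (fromℕ< j<d)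
    ... | no  _   = 0#

    extend-toℕ : ∀ x i → extend x (toℕ i) ≡ x i
    extend-toℕ x i with toℕ i ℕ.<? d
    ... | yes p = ≡.cong x (Fin.fromℕ<-toℕ i p)
    ... | no ¬p = ⊥-elim (¬p (Fin.toℕ<n i))

    inner : Vect d → Fin n → Carrier
    inner x u = sum (λ i → x i * V u i)

    dot-inner : ∀ x u → dot (extend x) (entry V (toℕ u)) ≈ inner x u
    dot-inner x u = trans (reflexive (S≡sum d _))
      (sum-cong-≋ (λ i → reflexive (≡.cong₂ _*_ (extend-toℕ x i) (entry-toℕ u i))))

    selected : (ℕ → ℕ) → ∀ k → Subset k
    selected m k = tabulate (λ i → 0 ℕ.<ᵇ m (toℕ i))

    -- Every selected index has multiplicity at least 1; repeated selections only help.
    ∣selected∣≤ : ∀ k m → fromℕ ∣ selected m k ∣ ≤ S k (fromℕ ∘ m)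
    ∣selected∣≤ zero    m = ≤-refl
    ∣selected∣≤ (suc k) m with m 0
    ... | zero  = ≤-respʳ (sym (+-identityˡ _)) (∣selected∣≤ k (m ∘ suc))
    ... | suc c = +-mono-≤ (x≤x+y (fromℕ-nonNegative c)) (∣selected∣≤ k (m ∘ suc))

    unselected : ∀ m (i : Fin n) → i ∉ selected m n → m (toℕ i) ≡ 0
    unselected m i i∉ with m (toℕ i) in eq
    ... | zero  = ≡.refl
    ... | suc c = ⊥-elim (i∉ (Vec.lookup⇒[]= i (selected m n)
                    (≡.trans (Vec.lookup∘tabulate _ i) (≡.cong (0 ℕ.<ᵇ_) eq))))

    module Output (s : State) (I : State2 (entry V) n s) where

      open Phase2 I

      m : ℕ → ℕ
      m = nats s 2

      r : Carrier
      r = (fromℕ N) ⁻¹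

      1≤fromℕN : 1# ≤ fromℕ N
      1≤fromℕN = ≤-respˡ fromℕ-1 (fromℕ-mono 1≤N)

      -- The uniform distribution on the multiset: an index chosen m times among N selections gets
      -- mass m / N. The same distribution serves every vector.
      distribution : Distribution (output {n} s)
      distribution = record
        { weight      = λ i → r * fromℕ (m (toℕ i))
        ; nonNegative = λ i → *-nonNegative (1≤⇒0≤⁻¹ 1≤fromℕN) (fromℕ-nonNegative (m (toℕ i)))
        ; supported   = λ i i∉ → trans (*-congˡ (reflexive (≡.cong fromℕ (unselected m i i∉)))) (zeroʳ r)
        ; total       = begin-equality
            sum {n} (λ i → r * fromℕ (m (toℕ i)))     ≈⟨ *-distribˡ-sum {n} r (fromℕ ∘ m ∘ toℕ) ⟨
            r * sum {n} (fromℕ ∘ m ∘ toℕ)         ≡⟨ ≡.cong (r *_) (S≡sum n (fromℕ ∘ m)) ⟨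
            r * S n (fromℕ ∘ m)                   ≈⟨ *-congˡ size ⟩
            r * fromℕ N                           ≈⟨ *-comm r (fromℕ N) ⟩
            fromℕ N * r                           ≈⟨ 1≤⇒inverse 1≤fromℕN ⟩
            1#                                    ∎
        }
        where open ≤-Reasoning

      form-inner : ∀ x → form m (entry V) (extend x) ≈ sum (λ u → fromℕ (m (toℕ u)) * sq (inner x u))
      form-inner x = trans (reflexive (S≡sum n _)) (sum-cong-≋ (λ u → *-congˡ (sq-cong (dot-inner x u))))

      inner-bound : ∀ x v → sq (inner x v) ≤ sum (λ u → fromℕ (m (toℕ u)) * sq (inner x u))
      inner-bound x v = begin
        sq (inner x v)                                    ≈⟨ sq-cong (dot-inner x v) ⟨
        sq (dot (extend x) (entry V (toℕ v)))             ≈⟨ sq-cong (proj₂ (spans (extend x)) (toℕ v) (Fin.toℕ<n v)) ⟩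
        sq (dot g (reals s 0 (toℕ v)))                    ≤⟨ covered (toℕ v) (Fin.toℕ<n v) (Fin.toℕ<n v) g ⟩
        form m (reals s 0) g                              ≈⟨ form-cong m (proj₂ (spans (extend x))) ⟨
        form m (entry V) (extend x)                       ≈⟨ form-inner x ⟩
        sum (λ u → fromℕ (m (toℕ u)) * sq (inner x u))    ∎
        where
        open ≤-Reasoning
        g = proj₁ (spans (extend x))

      α : Carrier
      α = fromℕ (bound d)

      -- Here the size bound becomes the approximation factor: averaging divides M by N, and α ≥ N
      -- makes up for it.
      1≤α*r : 1# ≤ α * r
      1≤α*r = ≤-respˡ (1≤⇒inverse 1≤fromℕN)
        (*-mono-≤ (1≤⇒0≤⁻¹ 1≤fromℕN) (fromℕ-nonNegative (bound d)) (fromℕ-mono (ℕ.<⇒≤ N<bound)) ≤-refl)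

      spectral : IsSpectralSpanner α V (output s)
      spectral v = distribution , record { symmetric = symmetric ; nonNegative = nonNegative }
        where
        open ≤-Reasoning
        M : Matrix d
        M = 𝔼 distribution (outer ∘ V)
        symmetric : ∀ i j → α * M i j - outer (V v) i j ≈ α * M j i - outer (V v) j i
        symmetric i j = +-cong
          (*-congˡ (sum-cong-≋ {n} (λ u → *-congˡ (*-comm (V u i) (V u j)))))
          (-‿cong (*-comm (V v i) (V v j)))
        nonNegative : ∀ x → 0# ≤ quadratic x (λ i j → α * M i j - outer (V v) i j)
        nonNegative x = ≤-respʳ (sym expand) (x≤y⇒0≤y-x (begin
          sq (inner x v)                   ≤⟨ inner-bound x v ⟩
          mass                                ≈⟨ *-identityˡ mass ⟨
          1# * mass                           ≤⟨ *-mono-≤ 0≤mass (≤-trans 0≤1 1≤α*r) 1≤α*r ≤-refl ⟩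
          α * r * mass                        ≈⟨ *-assoc α r mass ⟩
          α * (r * mass)                      ∎))
          where
          mass = sum (λ u → fromℕ (m (toℕ u)) * sq (inner x u))
          0≤mass : 0# ≤ mass
          0≤mass = ≤-trans (sq-nonNegative (inner x v)) (inner-bound x v)
          expand : quadratic x (λ i j → α * M i j - outer (V v) i j) ≈ α * (r * mass) - sq (inner x v)
          expand = begin-equality
            quadratic x (λ i j → α * M i j - outer (V v) i j)
              ≈⟨ quadratic-cong x (λ i j → solve 2 (λ y z → y :- z := y :+ (:- con (1 , 0)) :* z) refl (α * M i j) (outer (V v) i j)) ⟩
            quadratic x (λ i j → α * M i j + - 1# * outer (V v) i j)
              ≈⟨ quadratic-+ x (λ i j → α * M i j) (λ i j → - 1# * outer (V v) i j) ⟩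
            quadratic x (λ i j → α * M i j) + quadratic x (λ i j → - 1# * outer (V v) i j)
              ≈⟨ +-cong (quadratic-* x α M) (quadratic-* x (- 1#) (outer (V v))) ⟩
            α * quadratic x M + - 1# * quadratic x (outer (V v))
              ≈⟨ +-cong (*-congˡ expectation) (*-congˡ (quadratic-outer x (V v))) ⟩
            α * (r * mass) + - 1# * sq (inner x v)
              ≈⟨ solve 2 (λ y z → y :+ (:- con (1 , 0)) :* z := y :- z) refl (α * (r * mass)) (sq (inner x v)) ⟩
            α * (r * mass) - sq (inner x v) ∎
            where
            expectation : quadratic x M ≈ r * mass
            expectation = begin-equality
              quadratic x M
                ≈⟨ quadratic-sum x (Distribution.weight distribution) (outer ∘ V) ⟩
              sum (λ u → r * fromℕ (m (toℕ u)) * quadratic x (outer (V u)))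
                ≈⟨ sum-cong-≋ (λ u → trans (*-congˡ (quadratic-outer x (V u))) (*-assoc r (fromℕ (m (toℕ u))) (sq (inner x u)))) ⟩
              sum (λ u → r * (fromℕ (m (toℕ u)) * sq (inner x u)))
                ≈⟨ *-distribˡ-sum {n} r (λ u → fromℕ (m (toℕ u)) * sq (inner x u)) ⟨
              r * mass ∎

      small : ∣ output {n} s ∣ ℕ.≤ bound d
      small = ℕ.≤-trans (fromℕ-reflects-≤ ∣ output {n} s ∣ N (≤-respʳ size (∣selected∣≤ n m))) (ℕ.<⇒≤ N<bound)

-- The running time exponent and the conclusion

H^c≤k*H^k : ∀ c {H} → 1 ℕ.≤ H → H ℕ.^ c ℕ.≤ (2 ℕ.+ c) ℕ.* H ℕ.^ (2 ℕ.+ c)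
H^c≤k*H^k c {H@(suc _)} 1≤H = ℕ.≤-trans (ℕ.^-monoʳ-≤ H (ℕ.m≤n+m c 2)) (ℕ.m≤m+n _ _)

2≤k*H^k : ∀ c {H} → 1 ℕ.≤ H → 2 ℕ.≤ (2 ℕ.+ c) ℕ.* H ℕ.^ (2 ℕ.+ c)
2≤k*H^k c {H@(suc _)} 1≤H = ℕ.*-mono-≤ {2} (ℕ.m≤m+n 2 c) (ℕ.m^n>0 H (2 ℕ.+ c))

-- The summand 2 covers empty V, where the failing guard and `skip` take two steps although d + n
-- may be 1.
exponent : ℕ
exponent = 2 ℕ.+ cost spanner

spanner-correct : ∀ {a ℓ₁ ℓ₂} (R : Reals a ℓ₁ ℓ₂) → let open Spanners R in
  ∀ (d n : ℕ) → 1 ℕ.≤ d → (V : Vector (Vect d) n) →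
  Σ[ s ∈ State ] ∃[ t ] (⟨ spanner , input V ⟩⇓⟨ s , t ⟩ × t ℕ.≤ exponent ℕ.* (d ℕ.+ n) ℕ.^ exponent ×
    IsSpectralSpanner (fromℕ (Õ 8 1 d)) V (output s) × ∣ output {n} s ∣ ℕ.≤ Õ 8 1 d)
spanner-correct R d zero 1≤d V =
  input V , 2 , ⇓if-false ≡.refl ⇓skip , 2≤k*H^k (cost spanner) (ℕ.≤-trans 1≤d (ℕ.m≤m+n d 0)) , (λ ()) , z≤n
  where open Spanners R
spanner-correct R d n@(suc _) 1≤d V =
  final , time , evaluation , ℕ.≤-trans bounded (H^c≤k*H^k (cost spanner) (ℕ.≤-trans 1≤d (ℕ.m≤m+n d n))) ,
  Output.spectral V final post , Output.small V final post
  where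
  open Assembly R d n 1≤d (s≤s z≤n)
  open Execution.Run (run-spanner V)

open import Data.Nat using (_+_; _*_; _^_; _≤_; _<_)

theorem1p1 : ∀ {a ℓ₁ ℓ₂ : Level} →
    ∃[ C ] ∃[ c ] (0 < C × 0 < c ×
    (Σ[ P ∈ Program ] ∃[ k ]
    (∀ (R : Reals a ℓ₁ ℓ₂) → let open Spanners R in
    ∀ (d n : ℕ) → 1 ≤ d → (V : Vector (Vect d) n) → Distinct V →
    Σ[ s ∈ State ] ∃[ t ]
    (⟨ P , input V ⟩⇓⟨ s , t ⟩ ×
    t ≤ k * (d + n) ^ k ×
    IsSpectralSpanner (fromℕ (Õ C c d)) V (output s) ×
    ∣ output {n} s ∣ ≤ Õ C c d))) ×
    (∀ (R : Reals a ℓ₁ ℓ₂) → let open Spanners R in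
    ∀ (d n : ℕ) → 1 ≤ d → (V : Vector (Vect d) n) → Distinct V →
    Σ[ U ∈ Subset n ]
    (∣ U ∣ ≤ Õ C c d × IsSpectralSpanner (fromℕ (Õ C c d)) V U)))
theorem1p1 = 8 , 1 , s≤s z≤n , s≤s z≤n
  , (spanner , exponent , λ R d n 1≤d V _ → spanner-correct R d n 1≤d V)
  , λ R d n 1≤d V _ → let (s , _ , _ , _ , spectral , small) = spanner-correct R d n 1≤d V in
      Spanners.output R s , small , spectral
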